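{- The $\mathcal{G}$-invariant of a matroid is determined by its catenary data and conversely (that is, for two matroids $M,M'$ of rank $r$ on $n$ elements, $\mathcal{G}(M)=\mathcal{G}(M')$ if and only if $M$ and $M'$ have the same catenary data). In particular, for every rank-$r$ matroid $M$ on a set of $n$ elements, $$\mathcal{G}(M)=\sum_{(a_0,a_1,\ldots,a_r)}\nu(M;a_0,a_1,\ldots,a_r)\,\gamma(a_0,a_1,\ldots,a_r),$$ where the sum is over all $(n,r)$-compositions $(a_0,a_1,\ldots,a_r)$.
   Context: Matroids are on finite sets. An $(n,r)$-sequence is a $0,1$-sequence of length $n$ with exactly $r$ ones. $\mathcal{G}(n,r)$ is the vector space over a field of characteristic zero with basis the formal symbols $[\underline{r}]$, one for each $(n,r)$-sequence $\underline{r}$. For a rank-$r$ matroid $M$ with rank function $r(\cdot)$ on an $n$-element set $E$, and a permutation (linear ordering) $\pi=(\pi(1),\ldots,\pi(n))$ of $E$, the rank sequence $\underline{r}(\pi)=r_1r_2\ldots r_n$ is given by $r_1=r(\{\pi(1)\})$ and $r_j=r(\{\pi(1),\ldots,\pi(j)\})-r(\{\pi(1),\ldots,\pi(j-1)\})$ for $j\ge2$. The $\mathcal{G}$-invariant is $\mathcal{G}(M)=\sum_{\pi}[\underline{r}(\pi)]\in\mathcal{G}(n,r)$, the sum over all $n!$ permutations of $E$. An $(n,r)$-composition is an integer sequence $(a_0,a_1,\ldots,a_r)$ with $a_0\ge0$, $a_j>0$ for $1\le j\le r$, and $a_0+\cdots+a_r=n$. A flag of $M$ is a chain $X_0\subset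 X_1\subset\cdots\subset X_r=E$ of flats with $r(X_j)=j$ (so $X_0=\mathrm{cl}(\emptyset)$); its composition is $(|X_0|,|X_1-X_0|,\ldots,|X_r-X_{r-1}|)$. $\nu(M;a_0,\ldots,a_r)$ is the number of flags of $M$ with composition $(a_0,\ldots,a_r)$, and the catenary data of $M$ is the vector $(\nu(M;a_0,\ldots,a_r))$ indexed by $(n,r)$-compositions. Write $(b_0,\ldots,b_r)\trianglerighteq(a_0,\ldots,a_r)$ if $b_0+\cdots+b_j\le a_0+\cdots+a_j$ for all $j$, and let $(t)_k=t(t-1)\cdots(t-k+1)$. For an $(n,r)$-composition $(a_0,\ldots,a_r)$, $$\gamma(a_0,\ldots,a_r)=\sum_{(b_j)\trianglerighteq(a_j)}(a_0)_{b_0}\Biggl(\prod_{j=1}^r a_j\Bigl(a_j-1+\sum_{i=0}^{j-1}(a_i-b_i)\Bigr)_{b_j-1}\Biggr)[0^{b_0}10^{b_1-1}10^{b_2-1}\ldots10^{b_r-1}],$$ the sum over all $(n,r)$-compositions $(b_0,\ldots,b_r)\trianglerighteq(a_0,\ldots,a_r)$; here $0^{b}$ denotes $b$ consecutive $0$'s. -}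

module Defs where

open import Algebra.Apartness.Bundles using (HeytingField; HeytingCommutativeRing)
open import Algebra.Bundles using (CommutativeRing)
import Algebra.Definitions.RawMonoid as RawMonoidDefs
open import Data.Bool.Base using (if_then_else_)
open import Data.Empty using (⊥-elim)
open import Data.Fin.Base using (Fin; zero; suc; toℕ; fromℕ; inject₁; punchOut)
import Data.Fin.Properties as Fin
open import Data.Fin.Subset
  using (Subset; inside; outside; ⁅_⁆; ⋃; _∪_; _∩_; _─_; ∣_∣; _∈_; _∉_; _⊆_; _⊂_)
  renaming (⊥ to ∅; ⊤ to full)
open import Data.Fin.Subset.Properties
  using (_∈?_; _⊂?_; ∪-comm; ∪-assoc; p⊆p∪q; q⊆p∪q; x∈⁅x⁆; ∣⁅x⁆∣≡1; ∣⊥∣≡0; ⊆-antisym; ⊆⊤)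
open import Data.Irrelevant using (Irrelevant; [_])
open import Data.List.Base as List using (List; []; _∷_; _++_; length)
import Data.List.Properties as List
open import Data.List.Membership.Propositional using () renaming (_∈_ to _∈ₗ_)
open import Data.List.Relation.Unary.All as All using (All; []; _∷_)
import Data.List.Relation.Unary.All.Properties as All
open import Data.List.Relation.Unary.Any using (here; there)
open import Data.Nat.Base using (ℕ; zero; suc; _+_; _*_; _∸_; _≤_; _<_; z≤n; s≤s)
open import Data.Nat.Combinatorics.Base using (_P_)
open import Data.Nat.ListAction using (sum; product)
open import Data.Nat.Properties as ℕ using (_≟_; _<?_; _≤?_)
open import Data.Product.Base using (∃; _×_; _,_; proj₁)
open import Data.Refinement.Base using (Refinement-syntax; Refinement; value; _,_)
open import Data.Sum.Base using (_⊎_; inj₁; inj₂)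
open import Data.Vec.Base as Vec using (Vec; []; _∷_; lookup)
import Data.Vec.Properties as Vec
open import Data.Vec.Membership.Propositional.Properties using (∈-lookup; ∈-toList⁺)
open import Data.Vec.Relation.Unary.AllPairs using (allPairs?)
open import Data.Vec.Relation.Unary.Unique.Propositional using (Unique)
open import Data.Vec.Relation.Unary.Unique.Propositional.Properties using (lookup-injective)
open import Function.Base using (_∘_)
open import Level using (Level)
open import Relation.Binary.PropositionalEquality
open import Relation.Nullary.Decidable using (Dec; yes; no; does; ¬?; _×-dec_; _→-dec_)
open import Relation.Unary using (Pred; Decidable)

private
  variable
    ℓ ℓ′ : Level
    A : Set ℓ
    n r k : ℕ

-- Finite enumerations: every vector over xs, and every element of xs with
-- the property P.  If xs has no repetitions, neither do these lists.

vectors : List A → ∀ k → List (Vec A k)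
vectors xs zero    = [] ∷ []
vectors xs (suc k) = List.cartesianProductWith _∷_ xs (vectors xs k)

satisfying : {P : Pred A ℓ′} → Decidable P → List A → List [ x ∈ A ∣ P x ]
satisfying P? xs = All.reduce (λ {x} p → x , [ p ]) (All.all-filter P? xs)

record Matroid (n r : ℕ) : Set where
  field
    rank       : Subset n → ℕ
    rank≤size  : ∀ X → rank X ≤ ∣ X ∣
    monotone   : ∀ {X Y} → X ⊆ Y → rank X ≤ rank Y
    submodular : ∀ X Y → rank (X ∪ Y) + rank (X ∩ Y) ≤ rank X + rank Y
    rank-full  : rank full ≡ r

open Matroid using (rank)

IsSequence : ℕ → ℕ → List ℕ → Set
IsSequence n r s =
  length s ≡ n × All (λ d → d ≡ 0 ⊎ d ≡ 1) s × length (List.filter (_≟ 1) s) ≡ r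

Sequence : ℕ → ℕ → Set
Sequence n r = [ s ∈ List ℕ ∣ IsSequence n r s ]

Ordering : ℕ → Set
Ordering n = [ π ∈ Vec (Fin n) n ∣ Unique π ]

orderings : ∀ n → List (Ordering n)
orderings n =
  satisfying (allPairs? (λ x y → ¬? (x Fin.≟ y))) (vectors (List.allFin n) n)

union : List (Fin n) → Subset n
union xs = ⋃ (List.map ⁅_⁆ xs)

-- {π(1),…,π(j)}

initial : Vec (Fin n) n → ℕ → Subset n
initial π j = union (List.take j (Vec.toList π))

-- The uniform formula covers the first entry because rank ∅ = 0.

rankEntries : Matroid n r → Vec (Fin n) n → List ℕ
rankEntries {n} M π = List.tabulate {n = n} λ j →
  rank M (initial π (suc (toℕ j))) ∸ rank M (initial π (toℕ j))

private

  rank-∅ : (M : Matroid n r) → rank M ∅ ≡ 0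
  rank-∅ {n} M = ℕ.n≤0⇒n≡0 (subst (rank M ∅ ≤_) (∣⊥∣≡0 n) (Matroid.rank≤size M ∅))

  rank-∪⁅⁆ : (M : Matroid n r) → ∀ X e → rank M (X ∪ ⁅ e ⁆) ≤ suc (rank M X)
  rank-∪⁅⁆ M X e = begin
    rank M (X ∪ ⁅ e ⁆)                       ≤⟨ ℕ.m≤m+n _ _ ⟩
    rank M (X ∪ ⁅ e ⁆) + rank M (X ∩ ⁅ e ⁆)  ≤⟨ Matroid.submodular M X ⁅ e ⁆ ⟩
    rank M X + rank M ⁅ e ⁆                  ≤⟨ ℕ.+-monoʳ-≤ (rank M X) (Matroid.rank≤size M ⁅ e ⁆) ⟩
    rank M X + ∣ ⁅ e ⁆ ∣                     ≡⟨ cong (rank M X +_) (∣⁅x⁆∣≡1 e) ⟩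
    rank M X + 1                             ≡⟨ ℕ.+-comm (rank M X) 1 ⟩
    suc (rank M X)                           ∎
    where open ℕ.≤-Reasoning

  union-step : ∀ j (xs : List (Fin n)) →
    union (List.take (suc j) xs) ≡ union (List.take j xs) ⊎
    (∃ λ e → union (List.take (suc j) xs) ≡ union (List.take j xs) ∪ ⁅ e ⁆)
  union-step zero    []       = inj₁ refl
  union-step (suc j) []       = inj₁ refl
  union-step zero    (x ∷ xs) = inj₂ (x , ∪-comm ⁅ x ⁆ ∅)
  union-step (suc j) (x ∷ xs) with union-step j xs
  ... | inj₁ eq       = inj₁ (cong (⁅ x ⁆ ∪_) eq)
  ... | inj₂ (e , eq) =
    inj₂ (e , trans (cong (⁅ x ⁆ ∪_) eq) (sym (∪-assoc ⁅ x ⁆ _ ⁅ e ⁆)))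

  rank-step : (M : Matroid n r) (π : Vec (Fin n) n) → ∀ j →
    rank M (initial π j) ≤ rank M (initial π (suc j)) ×
    rank M (initial π (suc j)) ≤ suc (rank M (initial π j))
  rank-step M π j with union-step j (Vec.toList π)
  ... | inj₁ eq       rewrite eq = ℕ.≤-refl , ℕ.n≤1+n _
  ... | inj₂ (e , eq) rewrite eq =
    Matroid.monotone M (p⊆p∪q ⁅ e ⁆) , rank-∪⁅⁆ M _ e

  zeroOne : ∀ {x y} → x ≤ y → y ≤ suc x → y ∸ x ≡ 0 ⊎ y ∸ x ≡ 1
  zeroOne {zero}  {zero}        _         _         = inj₁ refl
  zeroOne {zero}  {suc zero}    _         _         = inj₂ refl
  zeroOne {zero}  {suc (suc _)} _         (s≤s ())
  zeroOne {suc x} {suc y}       (s≤s x≤y) (s≤s y≤x) = zeroOne x≤y y≤x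

  ones-∷ : ∀ {d} (s : List ℕ) → d ≡ 0 ⊎ d ≡ 1 →
           length (List.filter (_≟ 1) (d ∷ s)) ≡ d + length (List.filter (_≟ 1) s)
  ones-∷ s (inj₁ refl) = refl
  ones-∷ s (inj₂ refl) = refl

  telescope : ∀ n (g : ℕ → ℕ) → (∀ j → g j ≤ g (suc j) × g (suc j) ≤ suc (g j)) →
    length (List.filter (_≟ 1) (List.tabulate {n = n} λ j → g (suc (toℕ j)) ∸ g (toℕ j)))
      + g 0 ≡ g n
  telescope zero    g st = refl
  telescope (suc n) g st with st 0
  ... | lo , hi = begin
    length (List.filter (_≟ 1) (d ∷ s)) + g 0 ≡⟨ cong (_+ g 0) (ones-∷ s (zeroOne lo hi)) ⟩
    d + length (List.filter (_≟ 1) s) + g 0   ≡⟨ cong (_+ g 0) (ℕ.+-comm d _) ⟩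
    length (List.filter (_≟ 1) s) + d + g 0   ≡⟨ ℕ.+-assoc _ d (g 0) ⟩
    length (List.filter (_≟ 1) s) + (d + g 0) ≡⟨ cong (length (List.filter (_≟ 1) s) +_) (ℕ.m∸n+n≡m lo) ⟩
    length (List.filter (_≟ 1) s) + g 1       ≡⟨ telescope n (g ∘ suc) (st ∘ suc) ⟩
    g (suc n)                                 ∎
    where
    open ≡-Reasoning
    d : ℕ
    d = g 1 ∸ g 0
    s : List ℕ
    s = List.tabulate {n = n} λ j → g (suc (suc (toℕ j))) ∸ g (suc (toℕ j))

  covers : (π : Vec (Fin n) n) → Unique π → ∀ x → ∃ λ i → lookup π i ≡ x
  covers {suc n} π u x with Fin.any? (λ i → lookup π i Fin.≟ x)
  ... | yes p = p
  ... | no ¬p = ⊥-elim (Fin.<⇒notInjective {f = λ i → punchOut (x≢ i)} (ℕ.n<1+n n)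
                  (λ {i} {j} eq → lookup-injective u i j
                     (Fin.punchOut-injective (x≢ i) (x≢ j) eq)))
    where
    x≢ : ∀ i → x ≢ lookup π i
    x≢ i eq = ¬p (i , sym eq)

  ∈-union : ∀ {x} {xs : List (Fin n)} → x ∈ₗ xs → x ∈ union xs
  ∈-union {x = x} (here refl)        = p⊆p∪q _ (x∈⁅x⁆ x)
  ∈-union         (there {x = y} x∈) = q⊆p∪q ⁅ y ⁆ _ (∈-union x∈)

  initial-n : (π : Vec (Fin n) n) → Unique π → initial π n ≡ full
  initial-n {n} π u
    rewrite List.take-all n (Vec.toList π) (ℕ.≤-reflexive (Vec.length-toList π)) =
    ⊆-antisym ⊆⊤ (λ {x} _ → ∈-π x)
    where
    ∈-π : ∀ x → x ∈ union (Vec.toList π)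
    ∈-π x with covers π u x
    ... | i , refl = ∈-union (∈-toList⁺ (∈-lookup i π))

rankEntries-isSequence : (M : Matroid n r) (π : Vec (Fin n) n) → Unique π →
                         IsSequence n r (rankEntries M π)
rankEntries-isSequence {n} {r} M π u =
  List.length-tabulate {n = n} _ ,
  All.tabulate⁺ {n = n}
    (λ j → let lo , hi = rank-step M π (toℕ j) in zeroOne lo hi) ,
  (begin
    ones                          ≡⟨ sym (ℕ.+-identityʳ ones) ⟩
    ones + 0                      ≡⟨ cong (ones +_) (sym (rank-∅ M)) ⟩
    ones + rank M ∅               ≡⟨ telescope n (λ j → rank M (initial π j)) (rank-step M π) ⟩
    rank M (initial π n)          ≡⟨ cong (rank M) (initial-n π u) ⟩
    rank M full                   ≡⟨ Matroid.rank-full M ⟩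
    r                             ∎)
  where
  open ≡-Reasoning
  ones : ℕ
  ones = length (List.filter (_≟ 1) (rankEntries M π))

rankSequence : Matroid n r → Ordering n → Sequence n r
rankSequence M (π , [ u ]) = rankEntries M π , [ rankEntries-isSequence M π u ]

IsComposition : ∀ n r → Vec ℕ (suc r) → Set
IsComposition n r a = (∀ (j : Fin r) → 0 < lookup a (suc j)) × Vec.sum a ≡ n

isComposition? : ∀ n r → Decidable (IsComposition n r)
isComposition? n r a =
  Fin.all? (λ j → 0 <? lookup a (suc j)) ×-dec (Vec.sum a ≟ n)

Composition : ℕ → ℕ → Set
Composition n r = [ a ∈ Vec ℕ (suc r) ∣ IsComposition n r a ]

compositions : ∀ n r → List (Composition n r)
compositions n r = satisfying (isComposition? n r) (vectors (List.upTo (suc n)) (suc r))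

-- Partial sum of the first k entries: psum (a₀,…,aᵣ) k = a₀ + … + aₖ₋₁.

psum : Vec ℕ (suc r) → ℕ → ℕ
psum a k = sum (List.take k (Vec.toList a))

infix 4 _⊵_ _⊵?_

_⊵_ : Composition n r → Composition n r → Set
_⊵_ {r = r} b a =
  ∀ (j : Fin (suc r)) → psum (value b) (suc (toℕ j)) ≤ psum (value a) (suc (toℕ j))

_⊵?_ : (b a : Composition n r) → Dec (b ⊵ a)
b ⊵? a = Fin.all? (λ j → psum (value b) (suc (toℕ j)) ≤? psum (value a) (suc (toℕ j)))

-- The word 0^{b₀} 1 0^{b₁-1} … 1 0^{bᵣ-1}.

word : Vec ℕ (suc r) → List ℕ
word (b₀ ∷ bs) =
  List.replicate b₀ 0 ++ List.concatMap (λ b → 1 ∷ List.replicate (b ∸ 1) 0) (Vec.toList bs)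

private

  zeros-isSequence : ∀ m {s} → IsSequence n r s → IsSequence (m + n) r (List.replicate m 0 ++ s)
  zeros-isSequence zero    p = p
  zeros-isSequence (suc m) p with zeros-isSequence m p
  ... | l , z , o = cong suc l , inj₁ refl ∷ z , o

  blocks-isSequence : (bs : Vec ℕ k) → (∀ j → 0 < lookup bs j) →
    IsSequence (Vec.sum bs) k
      (List.concatMap (λ b → 1 ∷ List.replicate (b ∸ 1) 0) (Vec.toList bs))
  blocks-isSequence []           pos = refl , [] , refl
  blocks-isSequence (zero  ∷ bs) pos with pos zero
  ... | ()
  blocks-isSequence (suc b ∷ bs) pos
    with zeros-isSequence b (blocks-isSequence bs (pos ∘ suc))
  ... | l , z , o = cong suc l , inj₂ refl ∷ z , cong suc o

word-isSequence : (b : Vec ℕ (suc r)) → IsComposition n r b → IsSequence n r (word b)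
word-isSequence (b₀ ∷ bs) (pos , refl) = zeros-isSequence b₀ (blocks-isSequence bs pos)

wordSequence : Composition n r → Sequence n r
wordSequence (b , [ p ]) = word b , [ word-isSequence b p ]

IsFlat : Matroid n r → Subset n → Set
IsFlat M X = ∀ e → e ∉ X → rank M X < rank M (X ∪ ⁅ e ⁆)

isFlat? : (M : Matroid n r) → Decidable (IsFlat M)
isFlat? M X = Fin.all? (λ e → ¬? (e ∈? X) →-dec (rank M X <? rank M (X ∪ ⁅ e ⁆)))

IsFlag : Matroid n r → Vec (Subset n) (suc r) → Set
IsFlag {r = r} M X =
  (∀ j → IsFlat M (lookup X j)) ×
  (∀ j → rank M (lookup X j) ≡ toℕ j) ×
  (∀ (j : Fin r) → lookup X (inject₁ j) ⊂ lookup X (suc j)) ×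
  lookup X (fromℕ r) ≡ full

isFlag? : (M : Matroid n r) → Decidable (IsFlag M)
isFlag? {r = r} M X =
  Fin.all? (λ j → isFlat? M (lookup X j)) ×-dec
  (Fin.all? (λ j → rank M (lookup X j) ≟ toℕ j) ×-dec
  (Fin.all? (λ j → lookup X (inject₁ j) ⊂? lookup X (suc j)) ×-dec
  Vec.≡-dec Data.Bool._≟_ (lookup X (fromℕ r)) full))
  where import Data.Bool

flagComposition : Vec (Subset n) (suc r) → Vec ℕ (suc r)
flagComposition X =
  ∣ lookup X zero ∣ ∷ Vec.tabulate (λ j → ∣ lookup X (suc j) ─ lookup X (inject₁ j) ∣)

ν : Matroid n r → Composition n r → ℕ
ν {n} {r} M a = length (List.filter
  (λ X → isFlag? M X ×-dec Vec.≡-dec _≟_ (flagComposition X) (value a))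
  (vectors (vectors (inside ∷ outside ∷ []) n) (suc r)))

catenaryData : Matroid n r → Composition n r → ℕ
catenaryData = ν

-- The coefficient of [0^{b₀} 1 0^{b₁-1} … 1 0^{bᵣ-1}] in γ(a), for b ⊵ a.
-- t P k is the falling factorial (t)ₖ.  None of the truncated subtractions
-- truncates: positive parts give aⱼ, bⱼ ≥ 1, and b ⊵ a gives
-- b₀ + … + bⱼ₋₁ ≤ a₀ + … + aⱼ₋₁.

γ-coefficient : Vec ℕ (suc r) → Vec ℕ (suc r) → ℕ
γ-coefficient {r} a b =
  (lookup a zero P lookup b zero) * product (List.tabulate {n = r} factor)
  where
  factor : Fin r → ℕ
  factor i = let j = suc i in
    lookup a j *
    (((lookup a j ∸ 1) + (psum a (toℕ j) ∸ psum b (toℕ j))) P (lookup b j ∸ 1))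

module OverField {c ℓ₁ ℓ₂} (K : HeytingField c ℓ₁ ℓ₂) where

  private
    module K = HeytingField K
    module R = CommutativeRing
      (HeytingCommutativeRing.commutativeRing (HeytingField.heytingCommutativeRing K))

  open RawMonoidDefs R.+-rawMonoid using () renaming (_×_ to _×ᴷ_)

  ι : ℕ → K.Carrier
  ι m = m ×ᴷ K.1#

  CharacteristicZero : Set ℓ₁
  CharacteristicZero = ∀ m → ι m K.≈ K.0# → m ≡ 0

  -- There are finitely many (n,r)-sequences, so coefficient functions on
  -- them form the K-vector space with basis the (n,r)-sequences.

  𝒢-space : ℕ → ℕ → Set c
  𝒢-space n r = Sequence n r → K.Carrier

  infix  4 _≋_
  infixl 6 _⊕_
  infixr 7 _·_

  _≋_ : 𝒢-space n r → 𝒢-space n r → Set ℓ₁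
  g ≋ h = ∀ s → g s K.≈ h s

  𝟎 : 𝒢-space n r
  𝟎 s = K.0#

  _⊕_ : 𝒢-space n r → 𝒢-space n r → 𝒢-space n r
  (g ⊕ h) s = g s K.+ h s

  _·_ : K.Carrier → 𝒢-space n r → 𝒢-space n r
  (x · g) s = x K.* g s

  ∑ : List A → (A → 𝒢-space n r) → 𝒢-space n r
  ∑ xs f = List.foldr (λ x g → f x ⊕ g) 𝟎 xs

  ⟦_⟧ : Sequence n r → 𝒢-space n r
  ⟦ s ⟧ t = if does (List.≡-dec _≟_ (value s) (value t)) then K.1# else K.0#

  𝒢 : Matroid n r → 𝒢-space n r
  𝒢 {n} M = ∑ (orderings n) λ π → ⟦ rankSequence M π ⟧

  γ : Composition n r → 𝒢-space n r
  γ {n} {r} a = ∑ (List.filter (_⊵? a) (compositions n r)) λ b →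
    ι (γ-coefficient (value a) (value b)) · ⟦ wordSequence b ⟧

{-# OPTIONS --safe #-}

-- Reading an ordering π from left to right, the closures of its initial
-- segments form a flag of M, and the rank sequence of π is 0^{b₀}10^{b₁-1}…,
-- where b_j initial segments have the j-th flat as their closure (for j = 0,
-- not counting the empty one).  Choosing the elements one after the other shows
-- that a flag with composition a arises from as many orderings with a given b
-- as the coefficient in γ(a) says, and from none unless b ⊵ a.  Summing over all
-- flags gives the formula.  Conversely, these coefficients form a triangular
-- system with nonzero diagonal, so in characteristic zero the G-invariant
-- determines the catenary data.

module Submission where

open import Algebra.Apartness.Bundles using (HeytingField; HeytingCommutativeRing)
open import Algebra.Bundles using (CommutativeRing)
import Algebra.Properties.Group as GroupProperties
import Algebra.Properties.Semiring.Mult as SemiringMult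
open import Data.Bool.Base using (true; false; if_then_else_)
import Data.Bool.Properties as Bool
open import Data.Fin.Base using (Fin; zero; suc; toℕ; fromℕ; inject₁)
import Data.Fin.Properties as Fin
open import Data.Fin.Subset
  using (Subset; inside; outside; ⁅_⁆; _∪_; _∩_; _─_; ∣_∣; _∈_; _∉_; _⊆_; _⊂_)
  renaming (⊥ to ∅)
open import Data.Fin.Subset.Properties
open import Data.Irrelevant using ([_])
open import Data.List.Base as List
  using (List; []; _∷_; _++_; allFin; length; replicate; upTo)
import Data.List.Properties as List
open import Data.List.Relation.Unary.All as All using (All; []; _∷_)
open import Data.Nat using (ℕ)
open import Data.Nat.Base
open import Data.Nat.Combinatorics using (_P_; k>n⇒nPk≡0)
open import Data.Nat.Combinatorics.Specification using (nP′k≡n[n∸1P′k∸1])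
open import Data.Nat.ListAction using (sum; product)
open import Data.Nat.Properties
open import Data.Nat.Solver using (module +-*-Solver)
open import Data.Product using (_×_)
open import Data.Product.Base using (∃; ∃-syntax; _,_; proj₁; proj₂)
open import Data.Refinement.Base using (value; _,_)
open import Data.Refinement.Properties using (value-injective)
open import Data.Sum.Base using (_⊎_; inj₁; inj₂; [_,_]′)
open import Data.Unit.Base using (⊤; tt)
open import Data.Vec.Base as Vec using (Vec; []; _∷_; lookup; here; there)
import Data.Vec.Properties as Vec
open import Data.Vec.Relation.Unary.All as VecAll using ([]; _∷_)
open import Data.Vec.Relation.Unary.AllPairs using (allPairs?; []; _∷_)
open import Data.Vec.Relation.Unary.Unique.Propositional using (Unique)
open import Function.Base using (_∘_; id)
open import Function.Bundles using (_⇔_; mk⇔)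
open import Level using (Level)
open import Relation.Binary.Definitions using (DecidableEquality)
open import Relation.Binary.PropositionalEquality
open import Relation.Nullary
  using (¬_; Dec; yes; no; does; _because_; contradiction; ¬?; _×-dec_; _⊎-dec_; map′; recompute)
open import Relation.Nullary.Decidable using (decidable-stable)
open import Relation.Unary using (Pred; Decidable)
open import Defs

-- Two facts make the element-by-element count work. How a partial ordering can be continued depends
-- on the set `S` of its elements only through the closure and the size of `S`. And the flats
-- covering a flat `F` split the complement of `F` into disjoint classes, so choosing the element
-- that raises the rank amounts to choosing the next flat `X` and then one of the `∣ X ─ F ∣`
-- elements new in it: this is the factor `aⱼ`. The base of the falling factorial after it counts
-- the elements of `X` still unplaced, namely `aⱼ - 1` new ones and those left over from smaller
-- flats. All this takes place in `ℕ`; the field enters only at the end, through `ι`. The condition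
-- `b ⊵ a` becomes the vanishing of a falling factorial, so that sums can run over all compositions.
-- Since `⊵` is only a partial order, the triangular system is solved along a numerical measure.

private
  variable
    ℓ : Level
    A B Φ Ψ : Set ℓ
    k n r : ℕ

-- Indicators and finite sums

χ : Dec Φ → ℕ
χ d = if does d then 1 else 0

χ-yes : (d : Dec Φ) → Φ → χ d ≡ 1
χ-yes (yes _) p = refl
χ-yes (no ¬p) p = contradiction p ¬p

χ-no : (d : Dec Φ) → ¬ Φ → χ d ≡ 0
χ-no (yes p) ¬p = contradiction p ¬p
χ-no (no _)  ¬p = refl

χ-⇔ : (d : Dec Φ) (e : Dec Ψ) → (Φ → Ψ) → (Ψ → Φ) → χ d ≡ χ e
χ-⇔ (yes p) e f g = sym (χ-yes e (f p))
χ-⇔ (no ¬p) e f g = sym (χ-no e (¬p ∘ g))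

χ-× : (d : Dec Φ) (e : Dec Ψ) → χ (d ×-dec e) ≡ χ d * χ e
χ-× (yes _) (yes _) = refl
χ-× (yes _) (no _)  = refl
χ-× (no _)  e       = refl

χ-guard : (d : Dec Φ) {x y : ℕ} → (Φ → x ≡ y) → χ d * x ≡ χ d * y
χ-guard (yes p) eq = cong (1 *_) (eq p)
χ-guard (no _)  eq = refl

χ-absorb : (d : Dec Φ) {x : ℕ} → (¬ Φ → x ≡ 0) → χ d * x ≡ x
χ-absorb (yes p) {x} _ = *-identityˡ x
χ-absorb (no ¬p) eq  = sym (eq ¬p)

infix 8 ∑⟨_⟩_

∑⟨_⟩_ : List A → (A → ℕ) → ℕ
∑⟨ []     ⟩ f = 0
∑⟨ x ∷ xs ⟩ f = f x + ∑⟨ xs ⟩ f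

∑-cong : (xs : List A) {f g : A → ℕ} → f ≗ g → ∑⟨ xs ⟩ f ≡ ∑⟨ xs ⟩ g
∑-cong []       eq = refl
∑-cong (x ∷ xs) eq = cong₂ _+_ (eq x) (∑-cong xs eq)

∑-0 : (xs : List A) → ∑⟨ xs ⟩ (λ _ → 0) ≡ 0
∑-0 []       = refl
∑-0 (_ ∷ xs) = ∑-0 xs

∑-+ : (xs : List A) (f g : A → ℕ) → ∑⟨ xs ⟩ (λ x → f x + g x) ≡ (∑⟨ xs ⟩ f) + (∑⟨ xs ⟩ g)
∑-+ []       f g = refl
∑-+ (x ∷ xs) f g rewrite ∑-+ xs f g =
  solve 4 (λ a b c d → (a :+ b) :+ (c :+ d) := (a :+ c) :+ (b :+ d)) refl
    (f x) (g x) (∑⟨ xs ⟩ f) (∑⟨ xs ⟩ g)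
  where open +-*-Solver

∑-*ˡ : (xs : List A) (c : ℕ) (f : A → ℕ) → ∑⟨ xs ⟩ (λ x → c * f x) ≡ c * (∑⟨ xs ⟩ f)
∑-*ˡ []       c f = sym (*-zeroʳ c)
∑-*ˡ (x ∷ xs) c f rewrite ∑-*ˡ xs c f = sym (*-distribˡ-+ c (f x) _)

∑-*ʳ : (xs : List A) (f : A → ℕ) (c : ℕ) → ∑⟨ xs ⟩ (λ x → f x * c) ≡ (∑⟨ xs ⟩ f) * c
∑-*ʳ xs f c = trans (∑-cong xs λ x → *-comm (f x) c)
  (trans (∑-*ˡ xs c f) (*-comm c _))

∑-swap : (xs : List A) (ys : List B) (f : A → B → ℕ) →
  ∑⟨ xs ⟩ (λ x → ∑⟨ ys ⟩ λ y → f x y) ≡ ∑⟨ ys ⟩ (λ y → ∑⟨ xs ⟩ λ x → f x y)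
∑-swap []       ys f = sym (∑-0 ys)
∑-swap (x ∷ xs) ys f rewrite ∑-swap xs ys f = sym (∑-+ ys (f x) _)

∑-++ : (xs ys : List A) (f : A → ℕ) → ∑⟨ xs ++ ys ⟩ f ≡ (∑⟨ xs ⟩ f) + (∑⟨ ys ⟩ f)
∑-++ []       ys f = refl
∑-++ (x ∷ xs) ys f rewrite ∑-++ xs ys f = sym (+-assoc (f x) _ _)

∑-map : (xs : List A) (g : A → B) (f : B → ℕ) → ∑⟨ List.map g xs ⟩ f ≡ ∑⟨ xs ⟩ (f ∘ g)
∑-map []       g f = refl
∑-map (x ∷ xs) g f = cong (f (g x) +_) (∑-map xs g f)

∑-vectors : (xs : List A) (f : Vec A (suc k) → ℕ) →
  ∑⟨ vectors xs (suc k) ⟩ f ≡ ∑⟨ xs ⟩ (λ x → ∑⟨ vectors xs k ⟩ λ v → f (x ∷ v))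
∑-vectors {k = k} xs f = go xs
  where
  vs = vectors xs k
  go : ∀ ys → ∑⟨ List.cartesianProductWith _∷_ ys vs ⟩ f ≡ ∑⟨ ys ⟩ (λ x → ∑⟨ vs ⟩ λ v → f (x ∷ v))
  go []       = refl
  go (y ∷ ys) = trans (∑-++ (List.map (y ∷_) vs) _ f)
    (cong₂ _+_ (∑-map vs (y ∷_) f) (go ys))

∑-filter : {Φ : Pred A ℓ} (P? : Decidable Φ) (xs : List A) (f : A → ℕ) →
  ∑⟨ List.filter P? xs ⟩ f ≡ ∑⟨ xs ⟩ (λ x → χ (P? x) * f x)
∑-filter P? []       f = refl
∑-filter P? (x ∷ xs) f with P? x
... | true  because _ = cong₂ _+_ (sym (*-identityˡ (f x))) (∑-filter P? xs f)
... | false because _ = ∑-filter P? xs f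

length-filter : {Φ : Pred A ℓ} (P? : Decidable Φ) (xs : List A) →
  length (List.filter P? xs) ≡ ∑⟨ xs ⟩ (χ ∘ P?)
length-filter P? []       = refl
length-filter P? (x ∷ xs) with P? x
... | true  because _ = cong suc (length-filter P? xs)
... | false because _ = length-filter P? xs

map-value-satisfying : {Φ : Pred A ℓ} (P? : Decidable Φ) (xs : List A) →
  List.map value (satisfying P? xs) ≡ List.filter P? xs
map-value-satisfying P? []       = refl
map-value-satisfying P? (x ∷ xs) with P? x
... | true  because _ = cong (x ∷_) (map-value-satisfying P? xs)
... | false because _ = map-value-satisfying P? xs

∑-satisfying : {Φ : Pred A ℓ} (P? : Decidable Φ) (xs : List A) (f : A → ℕ) →
  ∑⟨ satisfying P? xs ⟩ (f ∘ value) ≡ ∑⟨ xs ⟩ (λ x → χ (P? x) * f x)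
∑-satisfying P? xs f = begin
  ∑⟨ satisfying P? xs ⟩ (f ∘ value)           ≡⟨ ∑-map (satisfying P? xs) value f ⟨
  ∑⟨ List.map value (satisfying P? xs) ⟩ f    ≡⟨ cong (∑⟨_⟩ f) (map-value-satisfying P? xs) ⟩
  ∑⟨ List.filter P? xs ⟩ f                    ≡⟨ ∑-filter P? xs f ⟩
  ∑⟨ xs ⟩ (λ x → χ (P? x) * f x)              ∎
  where open ≡-Reasoning

-- The hypothesis `∑⟨ xs ⟩ (χ ∘ a?) ≡ 1` says that `a` occurs exactly once in `xs`. This is the form
-- in which lists serve as finite sets throughout.
∑-point : (xs : List A) (a : A) (a? : ∀ x → Dec (x ≡ a)) → ∑⟨ xs ⟩ (χ ∘ a?) ≡ 1 →
  (f : A → ℕ) → ∑⟨ xs ⟩ (λ x → χ (a? x) * f x) ≡ f a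
∑-point xs a a? once f = begin
  ∑⟨ xs ⟩ (λ x → χ (a? x) * f x)  ≡⟨ ∑-cong xs (λ x → χ-guard (a? x) (cong f)) ⟩
  ∑⟨ xs ⟩ (λ x → χ (a? x) * f a)  ≡⟨ ∑-*ʳ xs (χ ∘ a?) (f a) ⟩
  (∑⟨ xs ⟩ (χ ∘ a?)) * f a        ≡⟨ cong (_* f a) once ⟩
  1 * f a                         ≡⟨ *-identityˡ (f a) ⟩
  f a                             ∎
  where open ≡-Reasoning

∑-mono-≤ : (xs : List A) {f g : A → ℕ} → (∀ x → f x ≤ g x) → ∑⟨ xs ⟩ f ≤ ∑⟨ xs ⟩ g
∑-mono-≤ []       le = z≤n
∑-mono-≤ (x ∷ xs) le = +-mono-≤ (le x) (∑-mono-≤ xs le)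

∑-split : (xs : List A) (a : A) (a? : ∀ x → Dec (x ≡ a)) → ∑⟨ xs ⟩ (χ ∘ a?) ≡ 1 →
  (f : A → ℕ) → ∑⟨ xs ⟩ f ≡ f a + ∑⟨ xs ⟩ (λ x → χ (¬? (a? x)) * f x)
∑-split xs a a? once f = begin
  ∑⟨ xs ⟩ f
    ≡⟨ ∑-cong xs (λ x → split (a? x)) ⟩
  ∑⟨ xs ⟩ (λ x → χ (a? x) * f x + χ (¬? (a? x)) * f x)
    ≡⟨ ∑-+ xs _ _ ⟩
  ∑⟨ xs ⟩ (λ x → χ (a? x) * f x) + ∑⟨ xs ⟩ (λ x → χ (¬? (a? x)) * f x)
    ≡⟨ cong (_+ ∑⟨ xs ⟩ (λ x → χ (¬? (a? x)) * f x)) (∑-point xs a a? once f) ⟩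
  f a + ∑⟨ xs ⟩ (λ x → χ (¬? (a? x)) * f x) ∎
  where
  open ≡-Reasoning
  split : ∀ {x} (d : Dec (x ≡ a)) → f x ≡ χ d * f x + χ (¬? d) * f x
  split (yes _) = sym (trans (+-identityʳ _) (*-identityˡ _))
  split (no _)  = sym (*-identityˡ _)

-- One step of back substitution carried out in `ℕ`: the terms away from `a` are cancelled from both
-- sides rather than subtracted.
∑-cancel : (xs : List A) (a : A) (a? : ∀ x → Dec (x ≡ a)) → ∑⟨ xs ⟩ (χ ∘ a?) ≡ 1 →
  (f g : A → ℕ) → (∀ x → x ≢ a → f x ≡ g x) → ∑⟨ xs ⟩ f ≡ ∑⟨ xs ⟩ g → f a ≡ g a
∑-cancel xs a a? once f g f≗g eq = +-cancelʳ-≡ (∑⟨ xs ⟩ (λ x → χ (¬? (a? x)) * f x)) _ _ (begin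
  f a + ∑⟨ xs ⟩ (λ x → χ (¬? (a? x)) * f x)  ≡⟨ ∑-split xs a a? once f ⟨
  ∑⟨ xs ⟩ f                                  ≡⟨ eq ⟩
  ∑⟨ xs ⟩ g                                  ≡⟨ ∑-split xs a a? once g ⟩
  g a + ∑⟨ xs ⟩ (λ x → χ (¬? (a? x)) * g x)
    ≡⟨ cong (g a +_) (∑-cong xs λ x → χ-guard (¬? (a? x)) (sym ∘ f≗g x)) ⟩
  g a + ∑⟨ xs ⟩ (λ x → χ (¬? (a? x)) * f x)  ∎)
  where open ≡-Reasoning

vectors-once : (_≟_ : DecidableEquality A) (xs : List A) (w : Vec A k) →
  (∀ i → ∑⟨ xs ⟩ (λ x → χ (x ≟ lookup w i)) ≡ 1) →
  ∑⟨ vectors xs k ⟩ (λ v → χ (Vec.≡-dec _≟_ v w)) ≡ 1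
vectors-once _≟_ xs []      once = refl
vectors-once _≟_ xs (y ∷ w) once = begin
  ∑⟨ vectors xs _ ⟩ (λ v → χ (v ≟ᵛ (y ∷ w)))
    ≡⟨ ∑-vectors xs _ ⟩
  ∑⟨ xs ⟩ (λ x → ∑⟨ vectors xs _ ⟩ λ v → χ ((x ∷ v) ≟ᵛ (y ∷ w)))
    ≡⟨ ∑-cong xs (λ x → ∑-cong (vectors xs _) λ v → trans
         (χ-⇔ ((x ∷ v) ≟ᵛ (y ∷ w)) (x ≟ y ×-dec v ≟ᵛ w)
           Vec.∷-injective (λ (p , q) → cong₂ _∷_ p q))
         (χ-× (x ≟ y) (v ≟ᵛ w))) ⟩
  ∑⟨ xs ⟩ (λ x → ∑⟨ vectors xs _ ⟩ λ v → χ (x ≟ y) * χ (v ≟ᵛ w))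
    ≡⟨ ∑-cong xs (λ x → ∑-*ˡ (vectors xs _) (χ (x ≟ y)) (λ v → χ (v ≟ᵛ w))) ⟩
  ∑⟨ xs ⟩ (λ x → χ (x ≟ y) * (∑⟨ vectors xs _ ⟩ λ v → χ (v ≟ᵛ w)))
    ≡⟨ ∑-point xs y (_≟ y) (once zero) _ ⟩
  ∑⟨ vectors xs _ ⟩ (λ v → χ (v ≟ᵛ w))
    ≡⟨ vectors-once _≟_ xs w (once ∘ suc) ⟩
  1 ∎
  where
  open ≡-Reasoning
  _≟ᵛ_ : ∀ {m} → DecidableEquality (Vec _ m)
  _≟ᵛ_ = Vec.≡-dec _≟_

∑-applyUpTo : ∀ m (g : ℕ → A) (f : A → ℕ) → ∑⟨ List.applyUpTo g m ⟩ f ≡ ∑⟨ upTo m ⟩ (f ∘ g)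
∑-applyUpTo m g f = trans (cong (∑⟨_⟩ f) (sym (List.map-upTo g m))) (∑-map (upTo m) g f)

upTo-once : ∀ {m i} → i < m → ∑⟨ upTo m ⟩ (λ x → χ (x ≟ i)) ≡ 1
upTo-once {suc m} {zero}  _         = cong suc (trans (∑-applyUpTo m suc _) (∑-0 (upTo m)))
upTo-once {suc m} {suc i} (s≤s i<m) = trans (∑-applyUpTo m suc _) (upTo-once i<m)

∑-tabulate : ∀ n (g : Fin n → A) (f : A → ℕ) → ∑⟨ List.tabulate g ⟩ f ≡ ∑⟨ allFin n ⟩ (f ∘ g)
∑-tabulate n g f = trans (cong (∑⟨_⟩ f) (sym (List.map-tabulate id g))) (∑-map (allFin _) g f)

allFin-once : (i : Fin n) → ∑⟨ allFin n ⟩ (λ x → χ (x Fin.≟ i)) ≡ 1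
allFin-once {suc n} zero    = cong suc (trans (∑-tabulate n suc _) (∑-0 (allFin n)))
allFin-once {suc n} (suc i) = trans (∑-tabulate n suc _) (allFin-once i)

subsets : ∀ n → List (Subset n)
subsets n = vectors (inside ∷ outside ∷ []) n

_≟ˢ_ : DecidableEquality (Subset n)
_≟ˢ_ = Vec.≡-dec Bool._≟_

subsets-once : (S : Subset n) → ∑⟨ subsets n ⟩ (λ X → χ (X ≟ˢ S)) ≡ 1
subsets-once S = vectors-once Bool._≟_ _ S λ i → side-once (lookup S i)
  where
  side-once : ∀ s → ∑⟨ inside ∷ outside ∷ [] ⟩ (λ x → χ (x Bool.≟ s)) ≡ 1
  side-once inside  = refl
  side-once outside = refl

∣∣≡∑ : (S : Subset n) → ∣ S ∣ ≡ ∑⟨ allFin n ⟩ (λ e → χ (e ∈? S))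
∣∣≡∑ []                    = refl
∣∣≡∑ {suc n} (inside  ∷ S) = cong suc (trans (∣∣≡∑ S) (sym (∑-tabulate n suc _)))
∣∣≡∑ {suc n} (outside ∷ S) = trans (∣∣≡∑ S) (sym (∑-tabulate n suc _))

-- Flats and extensions of partial orderings

-- Covers `k ≥ n` as well, where both sides are 0: a block of zeros too long for its flat has to be
-- counted as impossible, not excluded.
P-suc : ∀ n k → n P suc k ≡ n * ((n ∸ 1) P k)
P-suc zero    k       = refl
P-suc (suc n) zero    = refl
P-suc (suc n) (suc k) with suc k ≤ᵇ n
... | false = sym (*-zeroʳ n)
... | true  = nP′k≡n[n∸1P′k∸1] (suc n) (suc (suc k))

∪⁅⁆⊆ : ∀ {S F : Subset n} {e} → S ⊆ F → e ∈ F → S ∪ ⁅ e ⁆ ⊆ F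
∪⁅⁆⊆ {S = S} {e = e} S⊆F e∈F x∈ with x∈p∪q⁻ S ⁅ e ⁆ x∈
... | inj₁ x∈S = S⊆F x∈S
... | inj₂ x∈e rewrite x∈⁅y⁆⇒x≡y e x∈e = e∈F

∈∪⁅⁆ : ∀ (S : Subset n) e → e ∈ S ∪ ⁅ e ⁆
∈∪⁅⁆ S e = q⊆p∪q S ⁅ e ⁆ (x∈⁅x⁆ e)

∈─⁻ : ∀ {x} (p q : Subset n) → x ∈ p ─ q → x ∉ q
∈─⁻ (inside ∷ p) (outside ∷ q) here       ()
∈─⁻ (_      ∷ p) (_       ∷ q) (there x∈) (there x∈q) = ∈─⁻ p q x∈ x∈q

∣∪⁅⁆∣ : ∀ (S : Subset n) e → e ∉ S → ∣ S ∪ ⁅ e ⁆ ∣ ≡ suc ∣ S ∣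
∣∪⁅⁆∣ {n} S e e∉S = begin
  ∣ S ∪ ⁅ e ⁆ ∣
    ≡⟨ ∣∣≡∑ (S ∪ ⁅ e ⁆) ⟩
  ∑⟨ allFin n ⟩ (λ x → χ (x ∈? S ∪ ⁅ e ⁆))
    ≡⟨ ∑-cong (allFin n) split ⟩
  ∑⟨ allFin n ⟩ (λ x → χ (x Fin.≟ e) + χ (x ∈? S))
    ≡⟨ ∑-+ (allFin n) _ _ ⟩
  ∑⟨ allFin n ⟩ (λ x → χ (x Fin.≟ e)) + ∑⟨ allFin n ⟩ (λ x → χ (x ∈? S))
    ≡⟨ cong₂ _+_ (allFin-once e) (sym (∣∣≡∑ S)) ⟩
  suc ∣ S ∣ ∎
  where
  open ≡-Reasoning
  split : ∀ x → χ (x ∈? S ∪ ⁅ e ⁆) ≡ χ (x Fin.≟ e) + χ (x ∈? S)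
  split x with x Fin.≟ e
  ... | yes refl = trans (χ-yes (x ∈? S ∪ ⁅ e ⁆) (∈∪⁅⁆ S e)) (cong suc (sym (χ-no (x ∈? S) e∉S)))
  ... | no x≢e   = χ-⇔ (x ∈? S ∪ ⁅ e ⁆) (x ∈? S)
    (λ x∈ → [ id , (λ x∈e → contradiction (x∈⁅y⁆⇒x≡y e x∈e) x≢e) ]′ (x∈p∪q⁻ S ⁅ e ⁆ x∈))
    (p⊆p∪q ⁅ e ⁆)

∣─∣≡∑ : ∀ (F S : Subset n) → ∣ F ─ S ∣ ≡ ∑⟨ allFin n ⟩ (λ e → χ (¬? (e ∈? S)) * χ (e ∈? F))
∣─∣≡∑ {n} F S = trans (∣∣≡∑ (F ─ S)) (∑-cong (allFin n) λ e → trans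
  (χ-⇔ (e ∈? F ─ S) (¬? (e ∈? S) ×-dec e ∈? F)
    (λ e∈ → ∈─⁻ F S e∈ , p─q⊆p F S e∈)
    (λ (e∉S , e∈F) → x∈p∧x∉q⇒x∈p─q e∈F e∉S))
  (χ-× (¬? (e ∈? S)) (e ∈? F)))

∣─∣+∣∣ : ∀ {F S : Subset n} → S ⊆ F → ∣ S ∣ + ∣ F ─ S ∣ ≡ ∣ F ∣
∣─∣+∣∣ {n} {F} {S} S⊆F = begin
  ∣ S ∣ + ∣ F ─ S ∣
    ≡⟨ cong₂ _+_ (∣∣≡∑ S) (∣─∣≡∑ F S) ⟩
  ∑⟨ allFin n ⟩ (λ e → χ (e ∈? S)) + ∑⟨ allFin n ⟩ (λ e → χ (¬? (e ∈? S)) * χ (e ∈? F))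
    ≡⟨ ∑-+ (allFin n) _ _ ⟨
  ∑⟨ allFin n ⟩ (λ e → χ (e ∈? S) + χ (¬? (e ∈? S)) * χ (e ∈? F))
    ≡⟨ ∑-cong (allFin n) merge ⟩
  ∑⟨ allFin n ⟩ (λ e → χ (e ∈? F))
    ≡⟨ ∣∣≡∑ F ⟨
  ∣ F ∣ ∎
  where
  open ≡-Reasoning
  merge : ∀ e → χ (e ∈? S) + χ (¬? (e ∈? S)) * χ (e ∈? F) ≡ χ (e ∈? F)
  merge e with e ∈? S
  ... | yes e∈S = sym (χ-yes (e ∈? F) (S⊆F e∈S))
  ... | no _    = *-identityˡ _

∣─∣≡∸ : ∀ {F S : Subset n} → S ⊆ F → ∣ F ─ S ∣ ≡ ∣ F ∣ ∸ ∣ S ∣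
∣─∣≡∸ {F = F} {S} S⊆F = sym (trans (cong (_∸ ∣ S ∣) (sym (∣─∣+∣∣ S⊆F))) (m+n∸m≡n ∣ S ∣ _))

blocks : Vec ℕ k → List ℕ
blocks bs = List.concatMap (λ b → 1 ∷ replicate (b ∸ 1) 0) (Vec.toList bs)

-- The number of ways to build up a chain of flats of sizes f, f + a₁, … from
-- m elements of the first flat: within the j-th difference one chooses the
-- element that raises the rank, then b_j - 1 further elements of the new flat.

weight : ℕ → ℕ → Vec ℕ k → Vec ℕ k → ℕ
weight f m []       []       = 1
weight f m (a ∷ as) (b ∷ bs) =
  a * (((f + a ∸ suc m) P (b ∸ 1)) * weight (f + a) (suc m + (b ∸ 1)) as bs)

-- For compositions this is the coefficient in `γ` extended by 0 to pairs without `b ⊵ a`, as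
-- `γ-coefficient-⊵` shows.
compositionWeight : Vec ℕ (suc k) → Vec ℕ (suc k) → ℕ
compositionWeight (a ∷ as) (b ∷ bs) = (a P b) * weight a b as bs

sizes : Subset n → Vec (Subset n) k → Vec ℕ k
sizes F []       = []
sizes F (X ∷ Xs) = ∣ X ─ F ∣ ∷ sizes X Xs

flagComposition-sizes : (X : Subset n) (Xs : Vec (Subset n) k) →
  flagComposition (X ∷ Xs) ≡ ∣ X ∣ ∷ sizes X Xs
flagComposition-sizes X Xs = cong (∣ X ∣ ∷_) (go X Xs)
  where
  go : ∀ {k} X (Xs : Vec (Subset _) k) →
    Vec.tabulate (λ j → ∣ lookup (X ∷ Xs) (suc j) ─ lookup (X ∷ Xs) (inject₁ j) ∣) ≡ sizes X Xs
  go X []       = refl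
  go X (Y ∷ Ys) = cong (∣ Y ─ X ∣ ∷_) (go Y Ys)

-- Closures and covering flats

module _ (M : Matroid n r) where
  open Matroid M

  rank-∅ : rank ∅ ≡ 0
  rank-∅ = n≤0⇒n≡0 (subst (rank ∅ ≤_) (∣⊥∣≡0 n) (rank≤size ∅))

  rank-∪⁅⁆≤ : ∀ X e → rank (X ∪ ⁅ e ⁆) ≤ suc (rank X)
  rank-∪⁅⁆≤ X e = begin
    rank (X ∪ ⁅ e ⁆)                     ≤⟨ m≤m+n _ _ ⟩
    rank (X ∪ ⁅ e ⁆) + rank (X ∩ ⁅ e ⁆)  ≤⟨ submodular X ⁅ e ⁆ ⟩
    rank X + rank ⁅ e ⁆                  ≤⟨ +-monoʳ-≤ (rank X) (rank≤size ⁅ e ⁆) ⟩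
    rank X + ∣ ⁅ e ⁆ ∣                   ≡⟨ cong (rank X +_) (∣⁅x⁆∣≡1 e) ⟩
    rank X + 1                           ≡⟨ +-comm (rank X) 1 ⟩
    suc (rank X)                         ∎
    where open ≤-Reasoning

  flat-max : ∀ {X Y} → IsFlat M X → X ⊆ Y → rank Y ≤ rank X → Y ≡ X
  flat-max {X} {Y} flat X⊆Y rY≤rX = ⊆-antisym Y⊆X X⊆Y
    where
    Y⊆X : Y ⊆ X
    Y⊆X {e} e∈Y with e ∈? X
    ... | yes e∈X = e∈X
    ... | no  e∉X = contradiction (≤-trans (monotone (∪⁅⁆⊆ X⊆Y e∈Y)) rY≤rX) (<⇒≱ (flat e e∉X))

  -- F is the closure of S.

  record Spans (S F : Subset n) : Set where
    field
      ⊆flat : S ⊆ F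
      rank≡ : rank S ≡ rank F
      flat  : IsFlat M F

  open Spans

  -- Elements that keep the rank are added greedily. A set to which none can be added is a flat by
  -- definition. The fuel `k` bounds the number of elements still missing.
  closure : ∀ S → ∃ (Spans S)
  closure S = go n S (m≤m+n n ∣ S ∣)
    where
    go : ∀ k S → n ≤ k + ∣ S ∣ → ∃ (Spans S)
    go k S n≤ with Fin.any? (λ e → ¬? (e ∈? S) ×-dec rank (S ∪ ⁅ e ⁆) ≟ rank S)
    ... | no ¬any = S , record { ⊆flat = id ; rank≡ = refl ; flat = λ e e∉S →
            ≤∧≢⇒< (monotone (p⊆p∪q ⁅ e ⁆)) λ eq → ¬any (e , e∉S , sym eq) }
    -- Without fuel `S` already has `n` elements, so there is no room for `e`.
    go zero S n≤ | yes (e , e∉S , _) = contradiction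
      (≤-trans (≤-reflexive (sym (∣∪⁅⁆∣ S e e∉S))) (≤-trans (∣p∣≤n (S ∪ ⁅ e ⁆)) n≤)) (<-irrefl refl)
    go (suc k) S n≤ | yes (e , e∉S , eq)
      with F , sp ← go k (S ∪ ⁅ e ⁆) (subst (n ≤_)
                      (sym (trans (cong (k +_) (∣∪⁅⁆∣ S e e∉S)) (+-suc k ∣ S ∣))) n≤) =
      F , record { ⊆flat = ⊆flat sp ∘ p⊆p∪q ⁅ e ⁆ ; rank≡ = trans (sym eq) (rank≡ sp) ; flat = flat sp }

  module _ {S F} (sp : Spans S F) where

    rank-∈ : ∀ {e} → e ∈ F → rank (S ∪ ⁅ e ⁆) ≡ rank S
    rank-∈ {e} e∈F = ≤-antisym
      (≤-trans (monotone (∪⁅⁆⊆ (⊆flat sp) e∈F)) (≤-reflexive (sym (rank≡ sp))))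
      (monotone (p⊆p∪q ⁅ e ⁆))

    -- Submodularity of `F` and `S ∪ ⁅ e ⁆` carries the rise from the flat down to `S`: their union
    -- contains `F ∪ ⁅ e ⁆`, of rank above that of `F`, and their intersection contains `S`.
    rank-∉ : ∀ {e} → e ∉ F → rank (S ∪ ⁅ e ⁆) ≡ suc (rank S)
    rank-∉ {e} e∉F = ≤-antisym (rank-∪⁅⁆≤ S e) (+-cancelˡ-≤ (rank F) _ _ (begin
      rank F + suc (rank S)
        ≡⟨ +-suc (rank F) (rank S) ⟩
      suc (rank F) + rank S
        ≤⟨ +-mono-≤ (≤-trans (flat sp e e∉F) (monotone (∪⁅⁆⊆ (p⊆p∪q _) (q⊆p∪q F _ (∈∪⁅⁆ S e)))))
                    (monotone λ x∈ → x∈p∩q⁺ (⊆flat sp x∈ , p⊆p∪q ⁅ e ⁆ x∈)) ⟩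
      rank (F ∪ (S ∪ ⁅ e ⁆)) + rank (F ∩ (S ∪ ⁅ e ⁆))
        ≤⟨ submodular F (S ∪ ⁅ e ⁆) ⟩
      rank F + rank (S ∪ ⁅ e ⁆) ∎))
      where open ≤-Reasoning

    spans-∪ : ∀ {e} → e ∈ F → Spans (S ∪ ⁅ e ⁆) F
    spans-∪ e∈F = record
      { ⊆flat = ∪⁅⁆⊆ (⊆flat sp) e∈F ; rank≡ = trans (rank-∈ e∈F) (rank≡ sp) ; flat = flat sp }

    increment-0 : ∀ {e} → rank (S ∪ ⁅ e ⁆) ∸ rank S ≡ 0 → e ∈ F
    increment-0 {e} eq with e ∈? F
    ... | yes e∈F = e∈F
    ... | no  e∉F = contradiction (trans (sym eq)
      (trans (cong (_∸ rank S) (rank-∉ e∉F)) (m+n∸n≡m 1 (rank S)))) λ ()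

    -- F ∩ X still contains S, so by submodularity F ∪ X has the rank of F.

    spans-⊆ : ∀ {X} → S ⊆ X → IsFlat M X → F ⊆ X
    spans-⊆ {X} S⊆X flatX {e} e∈F with e ∈? X
    ... | yes e∈X = e∈X
    ... | no  e∉X = contradiction (begin-strict
      rank X + rank F
        <⟨ +-monoˡ-< (rank F) (flatX e e∉X) ⟩
      rank (X ∪ ⁅ e ⁆) + rank F
        ≤⟨ +-mono-≤ (monotone (∪⁅⁆⊆ (p⊆p∪q F) (q⊆p∪q X F e∈F)))
             (≤-trans (≤-reflexive (sym (rank≡ sp)))
               (monotone λ x∈ → x∈p∩q⁺ (S⊆X x∈ , ⊆flat sp x∈))) ⟩
      rank (X ∪ F) + rank (X ∩ F)
        ≤⟨ submodular X F ⟩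
      rank X + rank F ∎) (<-irrefl refl)
      where open ≤-Reasoning

  spans-unique : ∀ {S F X} → Spans S F → Spans S X → X ≡ F
  spans-unique F X = ⊆-antisym (spans-⊆ X (⊆flat F) (flat F)) (spans-⊆ F (⊆flat X) (flat X))

  Covers : Subset n → Subset n → Set
  Covers F X = IsFlat M X × rank X ≡ suc (rank F) × F ⊂ X

  covers? : ∀ F X → Dec (Covers F X)
  covers? F X = isFlat? M X ×-dec rank X ≟ suc (rank F) ×-dec F ⊂? X

  cover-spans : ∀ {S F X e} → Spans S F → Covers F X → e ∈ X → e ∉ F → Spans (S ∪ ⁅ e ⁆) X
  cover-spans sp (flatX , rX , F⊆X , _) e∈X e∉F = record
    { ⊆flat = ∪⁅⁆⊆ (F⊆X ∘ ⊆flat sp) e∈X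
    ; rank≡ = trans (rank-∉ sp e∉F) (trans (cong suc (rank≡ sp)) (sym rX))
    ; flat  = flatX }

  spans-cover : ∀ {S F X e} → Spans S F → e ∉ F → Spans (S ∪ ⁅ e ⁆) X → Covers F X × e ∈ X
  spans-cover {S} {F} {X} {e} sp e∉F sp′ =
    (flat sp′ , trans (sym (rank≡ sp′)) (trans (rank-∉ sp e∉F) (cong suc (rank≡ sp))) ,
     spans-⊆ sp (⊆flat sp′ ∘ p⊆p∪q ⁅ e ⁆) (flat sp′) , e , e∈X , e∉F) , e∈X
    where
    e∈X : e ∈ X
    e∈X = ⊆flat sp′ (∈∪⁅⁆ S e)

  -- The only cover of `F` through `e` is the closure of `S ∪ ⁅ e ⁆`. As a sum equal to 1, this fact
  -- can be inserted as a factor to introduce the next flat.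
  unique-cover : ∀ {S F e} → Spans S F → e ∉ F →
    ∑⟨ subsets n ⟩ (λ X → χ (covers? F X) * χ (e ∈? X)) ≡ 1
  unique-cover {S} {F} {e} sp e∉F with closure (S ∪ ⁅ e ⁆)
  ... | Y , spY = trans (∑-cong (subsets n) λ X → trans (sym (χ-× (covers? F X) (e ∈? X)))
      (χ-⇔ (covers? F X ×-dec e ∈? X) (X ≟ˢ Y)
        (λ (cov , e∈X) → spans-unique spY (cover-spans sp cov e∈X e∉F))
        λ { refl → spans-cover sp e∉F spY }))
    (subsets-once Y)

  -- Counting extensions along chains of flats

  Chain : Subset n → Vec (Subset n) k → Set
  Chain F []       = ⊤
  Chain F (X ∷ Xs) = Covers F X × Chain X Xs

  chain? : ∀ F (Xs : Vec (Subset n) k) → Dec (Chain F Xs)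
  chain? F []       = yes tt
  chain? F (X ∷ Xs) = covers? F X ×-dec chain? X Xs

  -- The number of ways to append distinct elements to an ordering of S so
  -- that the ranks increase by the entries of the list.

  extensions : Subset n → List ℕ → ℕ
  extensions S []      = 1
  extensions S (d ∷ s) = ∑⟨ allFin n ⟩ λ e →
    χ (¬? (e ∈? S)) * (χ (rank (S ∪ ⁅ e ⁆) ∸ rank S ≟ d) * extensions (S ∪ ⁅ e ⁆) s)

  -- An entry 0 means an element of `F` outside `S`; it leaves the closure unchanged and uses up one
  -- of `∣ F ∣ ∸ ∣ S ∣` free elements. Different choices lead to different sets `T`, so the
  -- continuation is assumed to have one value `c` for all `T` with the given closure and size.
  extensions-zeros : ∀ k {S F s c} → Spans S F →
    (∀ {T} → Spans T F → ∣ T ∣ ≡ k + ∣ S ∣ → extensions T s ≡ c) →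
    extensions S (replicate k 0 ++ s) ≡ ((∣ F ∣ ∸ ∣ S ∣) P k) * c
  extensions-zeros zero    {c = c} sp h = trans (h sp refl) (sym (*-identityˡ c))
  extensions-zeros (suc k) {S} {F} {s} {c} sp h = begin
    ∑⟨ allFin n ⟩ (λ e → χ (¬? (e ∈? S)) * (χ (increment e ≟ 0) * rest e))
      ≡⟨ ∑-cong (allFin n) (λ e → trans
           (χ-guard (¬? (e ∈? S)) λ e∉S → trans
             (cong (_* rest e) (χ-⇔ (increment e ≟ 0) (e ∈? F) (increment-0 sp) λ e∈F →
               trans (cong (_∸ rank S) (rank-∈ sp e∈F)) (n∸n≡0 (rank S))))
             (χ-guard (e ∈? F) (step e∉S)))
           (sym (*-assoc (χ (¬? (e ∈? S))) _ _))) ⟩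
    ∑⟨ allFin n ⟩ (λ e → χ (¬? (e ∈? S)) * χ (e ∈? F) * v)
      ≡⟨ ∑-*ʳ (allFin n) _ v ⟩
    ∑⟨ allFin n ⟩ (λ e → χ (¬? (e ∈? S)) * χ (e ∈? F)) * v
      ≡⟨ cong (_* v) (trans (sym (∣─∣≡∑ F S)) (∣─∣≡∸ (⊆flat sp))) ⟩
    (∣ F ∣ ∸ ∣ S ∣) * v
      ≡⟨ *-assoc (∣ F ∣ ∸ ∣ S ∣) _ c ⟨
    (∣ F ∣ ∸ ∣ S ∣) * ((∣ F ∣ ∸ ∣ S ∣ ∸ 1) P k) * c
      ≡⟨ cong (_* c) (P-suc (∣ F ∣ ∸ ∣ S ∣) k) ⟨
    ((∣ F ∣ ∸ ∣ S ∣) P suc k) * c ∎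
    where
    open ≡-Reasoning
    increment rest : Fin n → ℕ
    increment e = rank (S ∪ ⁅ e ⁆) ∸ rank S
    rest e = extensions (S ∪ ⁅ e ⁆) (replicate k 0 ++ s)
    v : ℕ
    v = ((∣ F ∣ ∸ ∣ S ∣ ∸ 1) P k) * c
    step : ∀ {e} → e ∉ S → e ∈ F → rest e ≡ v
    step {e} e∉S e∈F = trans
      (extensions-zeros k (spans-∪ sp e∈F) λ spT eq → h spT
        (trans eq (trans (cong (k +_) (∣∪⁅⁆∣ S e e∉S)) (+-suc k ∣ S ∣))))
      (cong (λ m → (m P k) * c) (trans (cong (∣ F ∣ ∸_) (trans (∣∪⁅⁆∣ S e e∉S) (+-comm 1 ∣ S ∣)))
        (sym (∸-+-assoc ∣ F ∣ ∣ S ∣ 1))))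

  -- A block starts with some `e` outside `F`. Sorting these `e` by the cover `X` of `F` that
  -- contains them, the zeros of the block stay inside `X`, and induction applies from `X`.
  extensions-blocks : (bs : Vec ℕ k) → ∀ {S F} → Spans S F →
    extensions S (blocks bs) ≡
    ∑⟨ vectors (subsets n) k ⟩ λ Xs → χ (chain? F Xs) * weight ∣ F ∣ ∣ S ∣ (sizes F Xs) bs
  extensions-blocks []       sp = refl
  extensions-blocks {suc k} (b ∷ bs) {S} {F} sp = begin
    ∑⟨ allFin n ⟩ (λ e → χ (¬? (e ∈? S)) * (χ (increment e ≟ 1) * rest e))
      ≡⟨ ∑-cong (allFin n) outer ⟩
    ∑⟨ allFin n ⟩ (λ e → ∑⟨ subsets n ⟩ λ X → χ (covers? F X) * (χ (¬? (e ∈? F)) * χ (e ∈? X) * rest e))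
      ≡⟨ ∑-swap (allFin n) (subsets n) _ ⟩
    ∑⟨ subsets n ⟩ (λ X → ∑⟨ allFin n ⟩ λ e → χ (covers? F X) * (χ (¬? (e ∈? F)) * χ (e ∈? X) * rest e))
      ≡⟨ ∑-cong (subsets n) inner ⟩
    ∑⟨ subsets n ⟩ (λ X → ∑⟨ vectors (subsets n) k ⟩ λ Xs →
      χ (chain? F (X ∷ Xs)) * weight ∣ F ∣ ∣ S ∣ (sizes F (X ∷ Xs)) (b ∷ bs))
      ≡⟨ ∑-vectors (subsets n) _ ⟨
    ∑⟨ vectors (subsets n) (suc k) ⟩ (λ Xs →
      χ (chain? F Xs) * weight ∣ F ∣ ∣ S ∣ (sizes F Xs) (b ∷ bs)) ∎
    where
    open ≡-Reasoning
    increment rest : Fin n → ℕ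
    increment e = rank (S ∪ ⁅ e ⁆) ∸ rank S
    rest e = extensions (S ∪ ⁅ e ⁆) (replicate (b ∸ 1) 0 ++ blocks bs)

    raise : ∀ e → e ∉ S × increment e ≡ 1 → e ∉ F
    raise e (e∉S , eq) e∈F = contradiction
      (trans (sym eq) (trans (cong (_∸ rank S) (rank-∈ sp e∈F)) (n∸n≡0 (rank S)))) λ ()

    raise⁻ : ∀ e → e ∉ F → e ∉ S × increment e ≡ 1
    raise⁻ e e∉F = e∉F ∘ ⊆flat sp , trans (cong (_∸ rank S) (rank-∉ sp e∉F)) (m+n∸n≡m 1 (rank S))

    outer : ∀ e → χ (¬? (e ∈? S)) * (χ (increment e ≟ 1) * rest e) ≡
      ∑⟨ subsets n ⟩ λ X → χ (covers? F X) * (χ (¬? (e ∈? F)) * χ (e ∈? X) * rest e)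
    outer e = begin
      χ (¬? (e ∈? S)) * (χ (increment e ≟ 1) * rest e)
        ≡⟨ *-assoc (χ (¬? (e ∈? S))) _ _ ⟨
      χ (¬? (e ∈? S)) * χ (increment e ≟ 1) * rest e
        ≡⟨ cong (_* rest e) (trans (sym (χ-× (¬? (e ∈? S)) (increment e ≟ 1)))
             (χ-⇔ (¬? (e ∈? S) ×-dec increment e ≟ 1) (¬? (e ∈? F)) (raise e) (raise⁻ e))) ⟩
      χ (¬? (e ∈? F)) * rest e
        -- The factor 1 is replaced by the number of covers of `F` through `e`, which brings in the
        -- sum over `X`.
        ≡⟨ χ-guard (¬? (e ∈? F)) (λ e∉F → trans (sym (*-identityˡ (rest e)))
             (cong (_* rest e) (sym (unique-cover sp e∉F)))) ⟩
      χ (¬? (e ∈? F)) * (∑⟨ subsets n ⟩ (λ X → χ (covers? F X) * χ (e ∈? X)) * rest e)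
        ≡⟨ cong (χ (¬? (e ∈? F)) *_) (∑-*ʳ (subsets n) _ (rest e)) ⟨
      χ (¬? (e ∈? F)) * ∑⟨ subsets n ⟩ (λ X → χ (covers? F X) * χ (e ∈? X) * rest e)
        ≡⟨ ∑-*ˡ (subsets n) (χ (¬? (e ∈? F))) _ ⟨
      ∑⟨ subsets n ⟩ (λ X → χ (¬? (e ∈? F)) * (χ (covers? F X) * χ (e ∈? X) * rest e))
        ≡⟨ ∑-cong (subsets n) (λ X → solve 4 (λ x y z w → x :* (y :* z :* w) := y :* (x :* z :* w)) refl
             (χ (¬? (e ∈? F))) (χ (covers? F X)) (χ (e ∈? X)) (rest e)) ⟩
      ∑⟨ subsets n ⟩ (λ X → χ (covers? F X) * (χ (¬? (e ∈? F)) * χ (e ∈? X) * rest e)) ∎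
      where open +-*-Solver

    module _ (X : Subset n) where
      later : Vec (Subset n) k → ℕ
      later Xs = weight ∣ X ∣ (suc ∣ S ∣ + (b ∸ 1)) (sizes X Xs) bs
      c v : ℕ
      c = ∑⟨ vectors (subsets n) k ⟩ λ Xs → χ (chain? X Xs) * later Xs
      v = ((∣ X ∣ ∸ suc ∣ S ∣) P (b ∸ 1)) * c

      -- Every `e` of `X` outside `F` leaves the same closure `X` and the same size `suc ∣ S ∣`, so
      -- `v` is independent of `e` and the sum over `e` becomes the factor `∣ X ─ F ∣`.
      rest≡v : Covers F X → ∀ e → e ∉ F × e ∈ X → rest e ≡ v
      rest≡v cov e (e∉F , e∈X) = trans
        (extensions-zeros (b ∸ 1) (cover-spans sp cov e∈X e∉F) λ {T} spT eq → trans
          (extensions-blocks bs spT)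
          (∑-cong (vectors (subsets n) k) λ Xs → cong (λ m → χ (chain? X Xs) * weight ∣ X ∣ m (sizes X Xs) bs)
            (trans eq (trans (cong (b ∸ 1 +_) ∣∪∣) (+-comm (b ∸ 1) _)))))
        (cong (λ m → ((∣ X ∣ ∸ m) P (b ∸ 1)) * c) ∣∪∣)
        where
        ∣∪∣ : ∣ S ∪ ⁅ e ⁆ ∣ ≡ suc ∣ S ∣
        ∣∪∣ = ∣∪⁅⁆∣ S e (e∉F ∘ ⊆flat sp)

      inner : ∑⟨ allFin n ⟩ (λ e → χ (covers? F X) * (χ (¬? (e ∈? F)) * χ (e ∈? X) * rest e)) ≡
        ∑⟨ vectors (subsets n) k ⟩ (λ Xs →
          χ (chain? F (X ∷ Xs)) * weight ∣ F ∣ ∣ S ∣ (sizes F (X ∷ Xs)) (b ∷ bs))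
      inner = begin
        ∑⟨ allFin n ⟩ (λ e → χ (covers? F X) * (χ (¬? (e ∈? F)) * χ (e ∈? X) * rest e))
          ≡⟨ ∑-cong (allFin n) (λ e → χ-guard (covers? F X) λ cov → trans
               (cong (_* rest e) (sym (χ-× (¬? (e ∈? F)) (e ∈? X))))
               (trans (χ-guard (¬? (e ∈? F) ×-dec e ∈? X) (rest≡v cov e))
                 (cong (_* v) (χ-× (¬? (e ∈? F)) (e ∈? X))))) ⟩
        ∑⟨ allFin n ⟩ (λ e → χ (covers? F X) * (χ (¬? (e ∈? F)) * χ (e ∈? X) * v))
          ≡⟨ ∑-*ˡ (allFin n) (χ (covers? F X)) _ ⟩
        χ (covers? F X) * ∑⟨ allFin n ⟩ (λ e → χ (¬? (e ∈? F)) * χ (e ∈? X) * v)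
          ≡⟨ cong (χ (covers? F X) *_) (trans (∑-*ʳ (allFin n) _ v) (cong (_* v) (sym (∣─∣≡∑ X F)))) ⟩
        χ (covers? F X) * (a * v)
          ≡⟨ cong (χ (covers? F X) *_) (*-assoc a _ c) ⟨
        χ (covers? F X) * (a * p * c)
          ≡⟨ *-assoc (χ (covers? F X)) _ c ⟨
        χ (covers? F X) * (a * p) * c
          ≡⟨ ∑-*ˡ (vectors (subsets n) k) (χ (covers? F X) * (a * p)) _ ⟨
        ∑⟨ vectors (subsets n) k ⟩ (λ Xs → χ (covers? F X) * (a * p) * (χ (chain? X Xs) * later Xs))
          ≡⟨ ∑-cong (vectors (subsets n) k) term ⟩
        ∑⟨ vectors (subsets n) k ⟩ (λ Xs →
          χ (chain? F (X ∷ Xs)) * weight ∣ F ∣ ∣ S ∣ (sizes F (X ∷ Xs)) (b ∷ bs)) ∎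
        where
        a p : ℕ
        a = ∣ X ─ F ∣
        p = (∣ X ∣ ∸ suc ∣ S ∣) P (b ∸ 1)
        term : ∀ Xs → χ (covers? F X) * (a * p) * (χ (chain? X Xs) * later Xs) ≡
          χ (chain? F (X ∷ Xs)) * weight ∣ F ∣ ∣ S ∣ (sizes F (X ∷ Xs)) (b ∷ bs)
        term Xs = begin
          χ (covers? F X) * (a * p) * (χ (chain? X Xs) * later Xs)
            ≡⟨ solve 5 (λ x y z w u → x :* (y :* z) :* (w :* u) := (x :* w) :* (y :* (z :* u))) refl
                 (χ (covers? F X)) a p (χ (chain? X Xs)) (later Xs) ⟩
          χ (covers? F X) * χ (chain? X Xs) * (a * (p * later Xs))
            ≡⟨ cong (_* (a * (p * later Xs))) (χ-× (covers? F X) (chain? X Xs)) ⟨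
          χ (chain? F (X ∷ Xs)) * (a * (p * later Xs))
            -- `weight` computes the size of the new flat as `∣ F ∣ + ∣ X ─ F ∣`, which is `∣ X ∣`
            -- because a cover contains `F`.
            ≡⟨ χ-guard (chain? F (X ∷ Xs)) (λ { ((_ , _ , F⊆X , _) , _) →
                 cong (λ m → a * (((m ∸ suc ∣ S ∣) P (b ∸ 1)) * weight m (suc ∣ S ∣ + (b ∸ 1)) (sizes X Xs) bs))
                   (sym (∣─∣+∣∣ F⊆X)) }) ⟩
          χ (chain? F (X ∷ Xs)) * weight ∣ F ∣ ∣ S ∣ (sizes F (X ∷ Xs)) (b ∷ bs) ∎
          where open +-*-Solver

  -- The ranks start at `i` instead of 0, so that the tail of such a sequence is again one, with
  -- `suc i`.
  IsFlagFrom : ℕ → Vec (Subset n) (suc k) → Set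
  IsFlagFrom {k} i X =
    (∀ j → IsFlat M (lookup X j)) ×
    (∀ j → rank (lookup X j) ≡ toℕ j + i) ×
    (∀ (j : Fin k) → lookup X (inject₁ j) ⊂ lookup X (suc j))

  flag⇒chain : ∀ {i} (X : Subset n) (Xs : Vec (Subset n) k) → IsFlagFrom i (X ∷ Xs) → Chain X Xs
  flag⇒chain X []       _             = tt
  flag⇒chain {i = i} X (Y ∷ Ys) (fl , rk , st) =
    (fl (suc zero) , trans (rk (suc zero)) (cong suc (sym (rk zero))) , st zero) ,
    flag⇒chain {i = suc i} Y Ys
      (fl ∘ suc , (λ j → trans (rk (suc j)) (sym (+-suc (toℕ j) i))) , st ∘ suc)

  chain⇒flag : ∀ {i} (X : Subset n) (Xs : Vec (Subset n) k) →
    IsFlat M X → rank X ≡ i → Chain X Xs → IsFlagFrom i (X ∷ Xs)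
  chain⇒flag X []       flX rkX _ = (λ { zero → flX }) , (λ { zero → rkX }) , λ ()
  chain⇒flag {i = i} X (Y ∷ Ys) flX rkX ((flY , rkY , X⊂Y) , chain)
    with fl , rk , st ← chain⇒flag {i = suc i} Y Ys flY (trans rkY (cong suc rkX)) chain =
    (λ { zero → flX ; (suc j) → fl j }) ,
    (λ { zero → rkX ; (suc j) → trans (rk j) (+-suc (toℕ j) i) }) ,
    (λ { zero → X⊂Y ; (suc j) → st j })

  -- The initial zeros are loops, so the first flat is forced to be the closure of `∅`. A sum over
  -- all candidates `X` for it is introduced by `∑-point` and merged with the sum over chains.
  extensions-word : ∀ b → extensions ∅ (word b) ≡
    ∑⟨ vectors (subsets n) (suc r) ⟩ λ X → χ (isFlag? M X) * compositionWeight (flagComposition X) b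
  extensions-word (b ∷ bs) with closure ∅
  ... | F , sp = begin
    extensions ∅ (replicate b 0 ++ blocks bs)
      ≡⟨ extensions-zeros b sp (λ spT eq → trans (extensions-blocks bs spT)
           (cong (λ m → ∑⟨ vectors (subsets n) r ⟩ λ Xs → χ (chain? F Xs) * weight ∣ F ∣ m (sizes F Xs) bs)
             (trans eq (trans (cong (b +_) (∣⊥∣≡0 n)) (+-identityʳ b))))) ⟩
    ((∣ F ∣ ∸ ∣ ∅ {n} ∣) P b) * c F
      ≡⟨ cong (λ m → ((∣ F ∣ ∸ m) P b) * c F) (∣⊥∣≡0 n) ⟩
    (∣ F ∣ P b) * c F
      ≡⟨ ∑-point (subsets n) F (_≟ˢ F) (subsets-once F) (λ X → (∣ X ∣ P b) * c X) ⟨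
    ∑⟨ subsets n ⟩ (λ X → χ (X ≟ˢ F) * ((∣ X ∣ P b) * c X))
      ≡⟨ ∑-cong (subsets n) (λ X → trans (sym (*-assoc (χ (X ≟ˢ F)) _ _))
           (sym (∑-*ˡ (vectors (subsets n) r) (χ (X ≟ˢ F) * (∣ X ∣ P b)) _))) ⟩
    ∑⟨ subsets n ⟩ (λ X → ∑⟨ vectors (subsets n) r ⟩ λ Xs → χ (X ≟ˢ F) * (∣ X ∣ P b) *
      (χ (chain? X Xs) * weight ∣ X ∣ b (sizes X Xs) bs))
      ≡⟨ ∑-cong (subsets n) (λ X → ∑-cong (vectors (subsets n) r) (term X)) ⟩
    ∑⟨ subsets n ⟩ (λ X → ∑⟨ vectors (subsets n) r ⟩ λ Xs →
      χ (isFlag? M (X ∷ Xs)) * compositionWeight (flagComposition (X ∷ Xs)) (b ∷ bs))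
      ≡⟨ ∑-vectors (subsets n) (λ X → χ (isFlag? M X) * compositionWeight (flagComposition X) (b ∷ bs)) ⟨
    ∑⟨ vectors (subsets n) (suc r) ⟩ (λ X →
      χ (isFlag? M X) * compositionWeight (flagComposition X) (b ∷ bs)) ∎
    where
    open ≡-Reasoning
    c : Subset n → ℕ
    c X = ∑⟨ vectors (subsets n) r ⟩ λ Xs → χ (chain? X Xs) * weight ∣ X ∣ b (sizes X Xs) bs

    flag⇒ : ∀ X Xs → IsFlag M (X ∷ Xs) → X ≡ F × Chain X Xs
    flag⇒ X Xs (fl , rk , st , _) =
      spans-unique sp (record { ⊆flat = ⊥⊆ ; rank≡ = trans rank-∅ (sym (rk zero)) ; flat = fl zero }) ,
      flag⇒chain {i = 0} X Xs (fl , (λ j → trans (rk j) (sym (+-identityʳ (toℕ j)))) , st)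

    ⇒flag : ∀ X Xs → X ≡ F × Chain X Xs → IsFlag M (X ∷ Xs)
    ⇒flag X Xs (refl , chain)
      with fl , rk , st ← chain⇒flag X Xs (flat sp) (trans (sym (rank≡ sp)) rank-∅) chain =
      fl , (λ j → trans (rk j) (+-identityʳ (toℕ j))) , st ,
      -- The last flat is `r` covers above rank 0, hence has the rank of `full` and by maximality
      -- equals it.
      sym (flat-max (fl (fromℕ r)) ⊆⊤ (≤-reflexive (trans rank-full
        (sym (trans (rk (fromℕ r)) (trans (+-identityʳ _) (Fin.toℕ-fromℕ r)))))))

    term : ∀ X Xs →
      χ (X ≟ˢ F) * (∣ X ∣ P b) * (χ (chain? X Xs) * weight ∣ X ∣ b (sizes X Xs) bs) ≡
      χ (isFlag? M (X ∷ Xs)) * compositionWeight (flagComposition (X ∷ Xs)) (b ∷ bs)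
    term X Xs = begin
      χ (X ≟ˢ F) * (∣ X ∣ P b) * (χ (chain? X Xs) * w)
        ≡⟨ solve 4 (λ x y z u → x :* y :* (z :* u) := x :* z :* (y :* u)) refl
             (χ (X ≟ˢ F)) (∣ X ∣ P b) (χ (chain? X Xs)) w ⟩
      χ (X ≟ˢ F) * χ (chain? X Xs) * ((∣ X ∣ P b) * w)
        ≡⟨ cong (_* ((∣ X ∣ P b) * w)) (trans (sym (χ-× (X ≟ˢ F) (chain? X Xs)))
             (χ-⇔ (X ≟ˢ F ×-dec chain? X Xs) (isFlag? M (X ∷ Xs)) (⇒flag X Xs) (flag⇒ X Xs))) ⟩
      χ (isFlag? M (X ∷ Xs)) * compositionWeight (∣ X ∣ ∷ sizes X Xs) (b ∷ bs)
        ≡⟨ cong (λ a → χ (isFlag? M (X ∷ Xs)) * compositionWeight a (b ∷ bs)) (flagComposition-sizes X Xs) ⟨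
      χ (isFlag? M (X ∷ Xs)) * compositionWeight (flagComposition (X ∷ Xs)) (b ∷ bs) ∎
      where
      open +-*-Solver
      w : ℕ
      w = weight ∣ X ∣ b (sizes X Xs) bs

-- Orderings

_≟ˡ_ : DecidableEquality (List ℕ)
_≟ˡ_ = List.≡-dec _≟_

unique? : (v : Vec (Fin n) k) → Dec (Unique v)
unique? = allPairs? (λ x y → ¬? (x Fin.≟ y))

-- Distinctness measured against the set of elements already placed, which is how `extensions` tests
-- it; `Unique` compares each entry with the later ones instead.
Fresh : Subset n → Vec (Fin n) k → Set
Fresh S []      = ⊤
Fresh S (x ∷ v) = x ∉ S × Fresh (S ∪ ⁅ x ⁆) v

fresh? : ∀ S (v : Vec (Fin n) k) → Dec (Fresh S v)
fresh? S []      = yes tt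
fresh? S (x ∷ v) = ¬? (x ∈? S) ×-dec fresh? (S ∪ ⁅ x ⁆) v

fresh⇒unique : ∀ S (v : Vec (Fin n) k) → Fresh S v → VecAll.All (_∉ S) v × Unique v
fresh⇒unique S []      _            = [] , []
fresh⇒unique S (x ∷ v) (x∉S , fr) with ∉ , u ← fresh⇒unique (S ∪ ⁅ x ⁆) v fr =
  x∉S ∷ VecAll.map (_∘ p⊆p∪q ⁅ x ⁆) ∉ ,
  VecAll.map (λ { y∉ refl → y∉ (∈∪⁅⁆ S x) }) ∉ ∷ u

unique⇒fresh : ∀ S (v : Vec (Fin n) k) → VecAll.All (_∉ S) v × Unique v → Fresh S v
unique⇒fresh S []      _                       = tt
unique⇒fresh S (x ∷ v) (x∉S ∷ ∉ , x≢ ∷ u) = x∉S , unique⇒fresh (S ∪ ⁅ x ⁆) v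
  (VecAll.map (λ (y∉S , x≢y) y∈ → [ y∉S , x≢y ∘ sym ∘ x∈⁅y⁆⇒x≡y x ]′ (x∈p∪q⁻ S ⁅ x ⁆ y∈))
    (VecAll.zip (∉ , x≢)) , u)

module _ (M : Matroid n r) where
  open Matroid M

  increments : Subset n → Vec (Fin n) k → List ℕ
  increments S []      = []
  increments S (x ∷ v) = rank (S ∪ ⁅ x ⁆) ∸ rank S ∷ increments (S ∪ ⁅ x ⁆) v

  increments≡tabulate : ∀ S (v : Vec (Fin n) k) → increments S v ≡
    List.tabulate {n = k} λ j →
      rank (S ∪ union (List.take (suc (toℕ j)) (Vec.toList v))) ∸
      rank (S ∪ union (List.take (toℕ j) (Vec.toList v)))
  increments≡tabulate S []      = refl
  increments≡tabulate S (x ∷ v) = cong₂ _∷_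
    (cong₂ (λ A B → rank A ∸ rank B)
      (cong (S ∪_) (sym (∪-identityʳ ⁅ x ⁆))) (sym (∪-identityʳ S)))
    (trans (increments≡tabulate (S ∪ ⁅ x ⁆) v) (List.tabulate-cong λ j →
      cong₂ (λ A B → rank A ∸ rank B) (∪-assoc S ⁅ x ⁆ _) (∪-assoc S ⁅ x ⁆ _)))

  rankEntries≡increments : (π : Vec (Fin n) n) → rankEntries M π ≡ increments ∅ π
  rankEntries≡increments π = sym (trans (increments≡tabulate ∅ π)
    (List.tabulate-cong {n = n} λ j → cong₂ (λ A B → rank A ∸ rank B) (∪-identityˡ _) (∪-identityˡ _)))

  fresh-count : ∀ S s → length s ≡ k →
    ∑⟨ vectors (allFin n) k ⟩ (λ v → χ (fresh? S v) * χ (increments S v ≟ˡ s)) ≡ extensions M S s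
  fresh-count {zero}  S []      _  = refl
  fresh-count {suc k} S (d ∷ s) eq = begin
    ∑⟨ vectors (allFin n) (suc k) ⟩ (λ v → χ (fresh? S v) * χ (increments S v ≟ˡ (d ∷ s)))
      ≡⟨ ∑-vectors (allFin n) (λ v → χ (fresh? S v) * χ (increments S v ≟ˡ (d ∷ s))) ⟩
    ∑⟨ allFin n ⟩ (λ e → ∑⟨ vectors (allFin n) k ⟩ λ v →
      χ (fresh? S (e ∷ v)) * χ (increments S (e ∷ v) ≟ˡ (d ∷ s)))
      ≡⟨ ∑-cong (allFin n) (λ e → trans (∑-cong (vectors (allFin n) k) (term e))
           (trans (∑-*ˡ (vectors (allFin n) k) (χ (¬? (e ∈? S)) * χ (inc e ≟ d)) _)
           (trans (*-assoc (χ (¬? (e ∈? S))) _ _)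
             (cong (λ c → χ (¬? (e ∈? S)) * (χ (inc e ≟ d) * c))
               (fresh-count (S ∪ ⁅ e ⁆) s (suc-injective eq)))))) ⟩
    extensions M S (d ∷ s) ∎
    where
    open ≡-Reasoning
    inc : Fin n → ℕ
    inc e = rank (S ∪ ⁅ e ⁆) ∸ rank S
    term : ∀ e (v : Vec (Fin n) k) → χ (fresh? S (e ∷ v)) * χ (increments S (e ∷ v) ≟ˡ (d ∷ s)) ≡
      χ (¬? (e ∈? S)) * χ (inc e ≟ d) * (χ (fresh? (S ∪ ⁅ e ⁆) v) * χ (increments (S ∪ ⁅ e ⁆) v ≟ˡ s))
    term e v = trans
      (cong₂ _*_ (χ-× (¬? (e ∈? S)) (fresh? (S ∪ ⁅ e ⁆) v))
        (trans (χ-⇔ (increments S (e ∷ v) ≟ˡ (d ∷ s)) (inc e ≟ d ×-dec increments (S ∪ ⁅ e ⁆) v ≟ˡ s)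
                 List.∷-injective (λ (p , q) → cong₂ _∷_ p q))
          (χ-× (inc e ≟ d) (increments (S ∪ ⁅ e ⁆) v ≟ˡ s))))
      (solve 4 (λ x y z w → (x :* y) :* (z :* w) := (x :* z) :* (y :* w)) refl
        (χ (¬? (e ∈? S))) (χ (fresh? (S ∪ ⁅ e ⁆) v)) (χ (inc e ≟ d)) (χ (increments (S ∪ ⁅ e ⁆) v ≟ˡ s)))
      where open +-*-Solver

  ordering-count : ∀ s → length s ≡ n →
    ∑⟨ orderings n ⟩ (λ π → χ (value (rankSequence M π) ≟ˡ s)) ≡ extensions M ∅ s
  ordering-count s eq = begin
    ∑⟨ orderings n ⟩ (λ π → χ (rankEntries M (value π) ≟ˡ s))
      ≡⟨ ∑-satisfying unique? (vectors (allFin n) n) (λ v → χ (rankEntries M v ≟ˡ s)) ⟩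
    ∑⟨ vectors (allFin n) n ⟩ (λ v → χ (unique? v) * χ (rankEntries M v ≟ˡ s))
      ≡⟨ ∑-cong (vectors (allFin n) n) (λ v → cong₂ _*_
           (χ-⇔ (unique? v) (fresh? ∅ v)
             (λ u → unique⇒fresh ∅ v (VecAll.universal (λ _ → ∉⊥) v , u))
             (proj₂ ∘ fresh⇒unique ∅ v))
           (cong (λ t → χ (t ≟ˡ s)) (rankEntries≡increments v))) ⟩
    ∑⟨ vectors (allFin n) n ⟩ (λ v → χ (fresh? ∅ v) * χ (increments ∅ v ≟ˡ s))
      ≡⟨ fresh-count ∅ s eq ⟩
    extensions M ∅ s ∎
    where open ≡-Reasoning

-- Weights and words of compositions

Positive : Vec ℕ k → Set
Positive as = ∀ i → 0 < lookup as i

partialSum : Vec ℕ k → ℕ → ℕ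
partialSum as j = sum (List.take j (Vec.toList as))

partialSum-injective : (as bs : Vec ℕ k) →
  (∀ (j : Fin k) → partialSum as (suc (toℕ j)) ≡ partialSum bs (suc (toℕ j))) → as ≡ bs
partialSum-injective []       []       _  = refl
partialSum-injective (a ∷ as) (b ∷ bs) eq
  with refl ← trans (sym (+-identityʳ a)) (trans (eq zero) (+-identityʳ b)) =
  cong (a ∷_) (partialSum-injective as bs λ j → +-cancelˡ-≡ a _ _ (eq (suc j)))

partialSum≤sum : (as : Vec ℕ k) → ∀ j → partialSum as j ≤ Vec.sum as
partialSum≤sum as       zero    = z≤n
partialSum≤sum []       (suc j) = z≤n
partialSum≤sum (a ∷ as) (suc j) = +-monoʳ-≤ a (partialSum≤sum as j)

-- `f` and `m` carry the partial sums of entries already removed, which lets the induction shift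
-- them. With `f = a₀` and `m = b₀` these are the factors of `γ-coefficient`.
factor : ℕ → ℕ → (as bs : Vec ℕ k) → Fin k → ℕ
factor f m as bs i = lookup as i *
  ((lookup as i ∸ 1 + ((f + partialSum as (toℕ i)) ∸ (m + partialSum bs (toℕ i)))) P (lookup bs i ∸ 1))

DominatedFrom : ℕ → ℕ → (as bs : Vec ℕ k) → Set
DominatedFrom {k} f m as bs = ∀ (j : Fin k) →
  m + partialSum bs (suc (toℕ j)) ≤ f + partialSum as (suc (toℕ j))

suc-+-∸1 : ∀ m {b} → 0 < b → suc m + (b ∸ 1) ≡ m + b
suc-+-∸1 m {suc b} _ = sym (+-suc m b)

weight-dominated : ∀ {f m} (as bs : Vec ℕ k) → Positive as → Positive bs → m ≤ f →
  DominatedFrom f m as bs → weight f m as bs ≡ product (List.tabulate (factor f m as bs))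
weight-dominated []       []       _    _    _   _   = refl
weight-dominated {f = f} {m} (a ∷ as) (b ∷ bs) posa posb m≤f dom = begin
  a * (((f + a ∸ suc m) P (b ∸ 1)) * weight (f + a) (suc m + (b ∸ 1)) as bs)
    ≡⟨ cong₂ (λ x y → a * ((x P (b ∸ 1)) * weight (f + a) y as bs)) (slack (posa zero)) (suc-+-∸1 m (posb zero)) ⟩
  a * (((a ∸ 1 + (f + 0 ∸ (m + 0))) P (b ∸ 1)) * weight (f + a) (m + b) as bs)
    ≡⟨ *-assoc a _ _ ⟨
  factor f m (a ∷ as) (b ∷ bs) zero * weight (f + a) (m + b) as bs
    ≡⟨ cong (factor f m (a ∷ as) (b ∷ bs) zero *_) (trans
         (weight-dominated as bs (posa ∘ suc) (posb ∘ suc) head tail)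
         (cong product (List.tabulate-cong λ i →
           cong₂ (λ x y → lookup as i * ((lookup as i ∸ 1 + (x ∸ y)) P (lookup bs i ∸ 1)))
             (+-assoc f a _) (+-assoc m b _)))) ⟩
  product (List.tabulate (factor f m (a ∷ as) (b ∷ bs))) ∎
  where
  open ≡-Reasoning
  head : m + b ≤ f + a
  head = subst₂ (λ x y → m + x ≤ f + y) (+-identityʳ b) (+-identityʳ a) (dom zero)
  tail : DominatedFrom (f + a) (m + b) as bs
  tail j = subst₂ _≤_ (sym (+-assoc m b _)) (sym (+-assoc f a _)) (dom (suc j))
  -- The unplaced elements of the new flat are `a ∸ 1` new ones and `f ∸ m` left over. The summands
  -- 0 are the empty partial sums in `factor` at index `zero`.
  slack : ∀ {a} → 0 < a → f + a ∸ suc m ≡ a ∸ 1 + (f + 0 ∸ (m + 0))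
  slack {suc a} _ = begin
    f + suc a ∸ suc m        ≡⟨ cong (_∸ suc m) (trans (+-suc f a) (cong suc (+-comm f a))) ⟩
    a + f ∸ m                ≡⟨ +-∸-assoc a m≤f ⟩
    a + (f ∸ m)              ≡⟨ cong (a +_) (cong₂ _∸_ (+-identityʳ f) (+-identityʳ m)) ⟨
    a + (f + 0 ∸ (m + 0))    ∎

*-≢0 : ∀ m {n} → m * n ≢ 0 → m ≢ 0 × n ≢ 0
*-≢0 m ≢0 = (λ { refl → ≢0 refl }) , λ { refl → ≢0 (*-zeroʳ m) }

P-≢0 : ∀ {n k} → n P k ≢ 0 → k ≤ n
P-≢0 ≢0 = ≮⇒≥ (≢0 ∘ k>n⇒nPk≡0)

-- A nonzero falling factorial is no longer than its base. For the first block this says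
-- `m + b ≤ f + a`, which is both the first inequality of dominance and the assumption `m ≤ f` for
-- the next block.
weight-≢0 : ∀ {f m} (as bs : Vec ℕ k) → Positive as → Positive bs → m ≤ f →
  weight f m as bs ≢ 0 → DominatedFrom f m as bs
weight-≢0 {f = f} {m} (a ∷ as) (b ∷ bs) posa posb m≤f ≢0 = λ
  { zero    → subst₂ (λ x y → m + x ≤ f + y) (sym (+-identityʳ b)) (sym (+-identityʳ a)) head
  ; (suc j) → subst₂ _≤_ (+-assoc m b _) (+-assoc f a _) (tail j) }
  where
  P≢0×rest≢0 = *-≢0 ((f + a ∸ suc m) P (b ∸ 1)) (proj₂ (*-≢0 a ≢0))
  suc-m≤f+a : suc m ≤ f + a
  suc-m≤f+a = ≤-trans (≤-reflexive (+-comm 1 m)) (+-mono-≤ m≤f (posa zero))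
  head : m + b ≤ f + a
  head = begin
    m + b                          ≡⟨ suc-+-∸1 m (posb zero) ⟨
    suc m + (b ∸ 1)                ≤⟨ +-monoʳ-≤ (suc m) (P-≢0 (proj₁ P≢0×rest≢0)) ⟩
    suc m + (f + a ∸ suc m)        ≡⟨ m+[n∸m]≡n suc-m≤f+a ⟩
    f + a                          ∎
    where open ≤-Reasoning
  tail : DominatedFrom (f + a) (m + b) as bs
  tail = weight-≢0 as bs (posa ∘ suc) (posb ∘ suc) head
    (subst (λ m′ → weight (f + a) m′ as bs ≢ 0) (suc-+-∸1 m (posb zero)) (proj₂ P≢0×rest≢0))

P-pos : ∀ {n k} → k ≤ n → 0 < n P k
P-pos {n}     {zero}  _         = s≤s z≤n
P-pos {suc n} {suc k} (s≤s k≤n) = subst (0 <_) (sym (P-suc (suc n) k)) (*-mono-≤ (s≤s (z≤n {n})) (P-pos k≤n))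

-- On the diagonal each flat is exhausted before the next begins, so every falling factorial is the
-- full `(a - 1)!`.
weight-diagonal : ∀ f (as : Vec ℕ k) → Positive as → 0 < weight f f as as
weight-diagonal f []       _   = s≤s z≤n
weight-diagonal f (a ∷ as) pos = *-mono-≤ (pos zero) (*-mono-≤
  (P-pos (≤-reflexive (sym (trans (cong (_∸ suc f) (sym (suc-+-∸1 f (pos zero)))) (m+n∸m≡n (suc f) _)))))
  (subst (λ m → 0 < weight (f + a) m as as) (sym (suc-+-∸1 f (pos zero)))
    (weight-diagonal (f + a) as (pos ∘ suc))))

isComposition : (a : Composition n r) → IsComposition n r (value a)
isComposition {n} {r} (a , [ p ]) = recompute (isComposition? n r a) p

compositionWeight-≢0 : (a b : Composition n r) → compositionWeight (value a) (value b) ≢ 0 → b ⊵ a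
compositionWeight-≢0 a b = go (value a) (value b) (proj₁ (isComposition a)) (proj₁ (isComposition b))
  where
  go : ∀ (a b : Vec ℕ (suc k)) →
    (∀ (j : Fin k) → 0 < lookup a (suc j)) → (∀ (j : Fin k) → 0 < lookup b (suc j)) →
    compositionWeight a b ≢ 0 → ∀ (j : Fin (suc k)) → psum b (suc (toℕ j)) ≤ psum a (suc (toℕ j))
  go (a ∷ as) (b ∷ bs) posa posb ≢0 with b≤a ← P-≢0 (proj₁ (*-≢0 (a P b) ≢0)) = λ
    { zero    → +-monoˡ-≤ 0 b≤a
    ; (suc j) → weight-≢0 as bs posa posb b≤a (proj₂ (*-≢0 (a P b) ≢0)) j }

compositionWeight≡γ-coefficient : (a b : Composition n r) → b ⊵ a →
  compositionWeight (value a) (value b) ≡ γ-coefficient (value a) (value b)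
compositionWeight≡γ-coefficient a b = go (value a) (value b) (proj₁ (isComposition a)) (proj₁ (isComposition b))
  where
  go : ∀ (a b : Vec ℕ (suc k)) →
    (∀ (j : Fin k) → 0 < lookup a (suc j)) → (∀ (j : Fin k) → 0 < lookup b (suc j)) →
    (∀ (j : Fin (suc k)) → psum b (suc (toℕ j)) ≤ psum a (suc (toℕ j))) →
    compositionWeight a b ≡ γ-coefficient a b
  go (a ∷ as) (b ∷ bs) posa posb b⊵a = cong ((a P b) *_)
    (weight-dominated as bs posa posb (subst₂ _≤_ (+-identityʳ b) (+-identityʳ a) (b⊵a zero)) (b⊵a ∘ suc))

γ-coefficient-⊵ : (a b : Composition n r) →
  χ (b ⊵? a) * γ-coefficient (value a) (value b) ≡ compositionWeight (value a) (value b)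
γ-coefficient-⊵ a b = trans
  (χ-guard (b ⊵? a) (sym ∘ compositionWeight≡γ-coefficient a b))
  (χ-absorb (b ⊵? a) λ ¬b⊵a →
    decidable-stable (_ ≟ 0) (¬b⊵a ∘ compositionWeight-≢0 a b))

compositionWeight-diagonal : (a : Composition n r) → 0 < compositionWeight (value a) (value a)
compositionWeight-diagonal a = go (value a) (proj₁ (isComposition a))
  where
  go : ∀ (a : Vec ℕ (suc k)) → (∀ (j : Fin k) → 0 < lookup a (suc j)) → 0 < compositionWeight a a
  go (a ∷ as) pos = *-mono-≤ (P-pos (≤-refl {a})) (weight-diagonal a as pos)

_≟ᶜ_ : DecidableEquality (Composition n r)
a ≟ᶜ b = map′ value-injective (cong value) (Vec.≡-dec _≟_ (value a) (value b))

lookup≤sum : (as : Vec ℕ k) → ∀ i → lookup as i ≤ Vec.sum as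
lookup≤sum (a ∷ as) zero    = m≤m+n a _
lookup≤sum (a ∷ as) (suc i) = ≤-trans (lookup≤sum as i) (m≤n+m _ a)

compositions-once : (a : Composition n r) → ∑⟨ compositions n r ⟩ (λ b → χ (b ≟ᶜ a)) ≡ 1
compositions-once {n} {r} a = begin
  ∑⟨ compositions n r ⟩ (λ b → χ (b ≟ᶜ a))
    ≡⟨ ∑-satisfying (isComposition? n r) xs (λ v → χ (v ≟ᵛ value a)) ⟩
  ∑⟨ xs ⟩ (λ v → χ (isComposition? n r v) * χ (v ≟ᵛ value a))
    ≡⟨ ∑-cong xs (λ v → χ-absorb (isComposition? n r v) λ ¬comp →
         χ-no (v ≟ᵛ value a) λ { refl → ¬comp (isComposition a) }) ⟩
  ∑⟨ xs ⟩ (λ v → χ (v ≟ᵛ value a))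
    -- No entry exceeds the total `n`, so each one occurs in `upTo (suc n)`.
    ≡⟨ vectors-once _≟_ (upTo (suc n)) (value a) (λ i → upTo-once
         (s≤s (≤-trans (lookup≤sum (value a) i) (≤-reflexive (proj₂ (isComposition a)))))) ⟩
  1 ∎
  where
  open ≡-Reasoning
  xs = vectors (upTo (suc n)) (suc r)
  _≟ᵛ_ : DecidableEquality (Vec ℕ (suc r))
  _≟ᵛ_ = Vec.≡-dec _≟_

-- Sequences as words of compositions

blocks-injective : (as bs : Vec ℕ k) → Positive as → Positive bs → blocks as ≡ blocks bs → as ≡ bs
-- The leading run of zeros can be read off because what follows is empty or begins with 1.
-- Positivity matters since `b ∸ 1` does not separate 0 from 1.
zeros-blocks-injective : ∀ a b (as bs : Vec ℕ k) → Positive as → Positive bs →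
  replicate a 0 ++ blocks as ≡ replicate b 0 ++ blocks bs → a ≡ b × as ≡ bs

blocks-injective []           []           _    _    _  = refl
blocks-injective (zero  ∷ as) (b     ∷ bs) posa posb eq = contradiction (posa zero) λ ()
blocks-injective (suc a ∷ as) (zero  ∷ bs) posa posb eq = contradiction (posb zero) λ ()
blocks-injective (suc a ∷ as) (suc b ∷ bs) posa posb eq
  with refl , refl ← zeros-blocks-injective a b as bs (posa ∘ suc) (posb ∘ suc) (List.∷-injectiveʳ eq) = refl

zeros-blocks-injective zero    zero    as       bs       posa posb eq = refl , blocks-injective as bs posa posb eq
zeros-blocks-injective zero    (suc b) []       bs       posa posb ()
zeros-blocks-injective zero    (suc b) (a ∷ as) bs       posa posb ()
zeros-blocks-injective (suc a) zero    as       []       posa posb ()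
zeros-blocks-injective (suc a) zero    as       (b ∷ bs) posa posb ()
zeros-blocks-injective (suc a) (suc b) as       bs       posa posb eq
  with refl , refl ← zeros-blocks-injective a b as bs posa posb (List.∷-injectiveʳ eq) = refl , refl

word-injective : (a b : Composition n r) → word (value a) ≡ word (value b) → a ≡ b
word-injective a b eq = value-injective
  (go (value a) (value b) (proj₁ (isComposition a)) (proj₁ (isComposition b)) eq)
  where
  go : ∀ (a b : Vec ℕ (suc k)) →
    (∀ (j : Fin k) → 0 < lookup a (suc j)) → (∀ (j : Fin k) → 0 < lookup b (suc j)) →
    word a ≡ word b → a ≡ b
  go (a ∷ as) (b ∷ bs) posa posb eq
    with refl , refl ← zeros-blocks-injective a b as bs posa posb eq = refl

-- Read from the right, a 0 lengthens the initial run `a`; a 1 closes that run into a block of size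
-- `suc a` and opens a new, empty one.
parse : ∀ s → All (λ d → d ≡ 0 ⊎ d ≡ 1) s →
  ∃[ a ] (∀ (j : Fin (length (List.filter (_≟ 1) s))) → 0 < lookup a (suc j)) × word a ≡ s
parse []      []              = 0 ∷ [] , (λ ()) , refl
parse (_ ∷ s) (inj₁ refl ∷ z) with parse s z
... | a ∷ as , pos , eq = suc a ∷ as , pos , cong (0 ∷_) eq
parse (_ ∷ s) (inj₂ refl ∷ z) with parse s z
... | a ∷ as , pos , eq = 0 ∷ suc a ∷ as , (λ { zero → s≤s z≤n ; (suc j) → pos j }) , cong (1 ∷_) eq

-- With `word-injective`, compositions label the basis of `𝒢-space`, so an identity there may be
-- checked at words.
word-surjective : (s : Sequence n r) → ∃[ a ] word (value {P = IsComposition n r} a) ≡ value s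
word-surjective {n} {r} (s , [ p ])
  with refl , z , refl ← recompute (length s ≟ n ×-dec
         (All.all? (λ d → d ≟ 0 ⊎-dec d ≟ 1) s ×-dec length (List.filter (_≟ 1) s) ≟ r)) p
  with a , pos , eq ← parse s z =
  (a , [ pos , trans (sym (proj₁ (word-isSequence a (pos , refl)))) (cong length eq) ]) , eq

-- Catenary data

sum-sizes : (X : Subset n) (Xs : Vec (Subset n) k) →
  (∀ (j : Fin k) → lookup (X ∷ Xs) (inject₁ j) ⊂ lookup (X ∷ Xs) (suc j)) →
  ∣ X ∣ + Vec.sum (sizes X Xs) ≡ ∣ lookup (X ∷ Xs) (fromℕ k) ∣
sum-sizes X []       _  = +-identityʳ ∣ X ∣
sum-sizes X (Y ∷ Ys) st = begin
  ∣ X ∣ + (∣ Y ─ X ∣ + Vec.sum (sizes Y Ys))  ≡⟨ +-assoc ∣ X ∣ _ _ ⟨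
  ∣ X ∣ + ∣ Y ─ X ∣ + Vec.sum (sizes Y Ys)    ≡⟨ cong (_+ Vec.sum (sizes Y Ys)) (∣─∣+∣∣ (proj₁ (st zero))) ⟩
  ∣ Y ∣ + Vec.sum (sizes Y Ys)                ≡⟨ sum-sizes Y Ys (st ∘ suc) ⟩
  ∣ lookup (Y ∷ Ys) (fromℕ _) ∣               ∎
  where open ≡-Reasoning

flagComposition-isComposition : (M : Matroid n r) (X : Vec (Subset n) (suc r)) →
  IsFlag M X → IsComposition n r (flagComposition X)
flagComposition-isComposition {n} {r} M (X ∷ Xs) (_ , _ , st , last) =
  (λ j → subst (0 <_) (sym (Vec.lookup∘tabulate _ j)) (difference-pos (st j))) ,
  trans (cong Vec.sum (flagComposition-sizes X Xs))
    (trans (sum-sizes X Xs st) (trans (cong ∣_∣ last) (∣⊤∣≡n n)))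
  where
  difference-pos : ∀ {X Y : Subset n} → X ⊂ Y → 0 < ∣ Y ─ X ∣
  difference-pos {X} {Y} X⊂Y = subst (0 <_) (sym (∣─∣≡∸ (proj₁ X⊂Y))) (m<n⇒0<n∸m (p⊂q⇒∣p∣<∣q∣ X⊂Y))

-- The weight of a flag depends only on its composition, which occurs once in `compositions`;
-- grouping the flags accordingly leaves `ν` as the only trace of `M`.
catenary-count : (M : Matroid n r) (b : Composition n r) →
  extensions M ∅ (word (value b)) ≡
  ∑⟨ compositions n r ⟩ λ a → ν M a * compositionWeight (value a) (value b)
catenary-count {n} {r} M b = begin
  extensions M ∅ (word (value b))
    ≡⟨ extensions-word M (value b) ⟩
  ∑⟨ chains ⟩ (λ X → χ (isFlag? M X) * W (flagComposition X))
    ≡⟨ ∑-cong chains (λ X → χ-guard (isFlag? M X) (regroup X)) ⟩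
  ∑⟨ chains ⟩ (λ X → χ (isFlag? M X) *
    ∑⟨ compositions n r ⟩ λ a → χ (flagComposition X ≟ᵛ value a) * W (value a))
    ≡⟨ ∑-cong chains (λ X → trans
         (sym (∑-*ˡ (compositions n r) (χ (isFlag? M X)) _))
         (∑-cong (compositions n r) λ a → sym (*-assoc (χ (isFlag? M X)) _ _))) ⟩
  ∑⟨ chains ⟩ (λ X → ∑⟨ compositions n r ⟩ λ a →
    χ (isFlag? M X) * χ (flagComposition X ≟ᵛ value a) * W (value a))
    ≡⟨ ∑-swap chains (compositions n r) _ ⟩
  ∑⟨ compositions n r ⟩ (λ a → ∑⟨ chains ⟩ λ X →
    χ (isFlag? M X) * χ (flagComposition X ≟ᵛ value a) * W (value a))
    ≡⟨ ∑-cong (compositions n r) (λ a → trans (∑-*ʳ chains _ (W (value a)))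
         (cong (_* W (value a)) (sym (ν-count a)))) ⟩
  ∑⟨ compositions n r ⟩ (λ a → ν M a * W (value a)) ∎
  where
  open ≡-Reasoning
  chains = vectors (subsets n) (suc r)
  W : Vec ℕ (suc r) → ℕ
  W a = compositionWeight a (value b)
  _≟ᵛ_ : DecidableEquality (Vec ℕ (suc r))
  _≟ᵛ_ = Vec.≡-dec _≟_

  regroup : ∀ X → IsFlag M X →
    W (flagComposition X) ≡ ∑⟨ compositions n r ⟩ λ a → χ (flagComposition X ≟ᵛ value a) * W (value a)
  regroup X flag = sym (trans
    (∑-cong (compositions n r) λ a → cong (_* W (value a))
      (χ-⇔ (flagComposition X ≟ᵛ value a) (a ≟ᶜ c) (value-injective ∘ sym) (sym ∘ cong value)))
    (∑-point (compositions n r) c (_≟ᶜ c) (compositions-once c) (W ∘ value)))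
    where
    c : Composition n r
    c = flagComposition X , [ flagComposition-isComposition M X flag ]

  ν-count : ∀ a → ν M a ≡ ∑⟨ chains ⟩ λ X → χ (isFlag? M X) * χ (flagComposition X ≟ᵛ value a)
  ν-count a = trans (length-filter (λ X → isFlag? M X ×-dec flagComposition X ≟ᵛ value a) chains)
    (∑-cong chains λ X → χ-× (isFlag? M X) (flagComposition X ≟ᵛ value a))

-- Distinct compositions have distinct words, so only `c = b` contributes to the coefficient at the
-- word of `b`.
γ-count : (a b : Composition n r) →
  ∑⟨ List.filter (_⊵? a) (compositions n r) ⟩ (λ c →
    γ-coefficient (value a) (value c) * χ (word (value c) ≟ˡ word (value b))) ≡
  compositionWeight (value a) (value b)
γ-count {n} {r} a b = begin
  ∑⟨ List.filter (_⊵? a) (compositions n r) ⟩ (λ c →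
    γ-coefficient (value a) (value c) * χ (word (value c) ≟ˡ word (value b)))
    ≡⟨ ∑-filter (_⊵? a) (compositions n r) _ ⟩
  ∑⟨ compositions n r ⟩ (λ c →
    χ (c ⊵? a) * (γ-coefficient (value a) (value c) * χ (word (value c) ≟ˡ word (value b))))
    ≡⟨ ∑-cong (compositions n r) term ⟩
  ∑⟨ compositions n r ⟩ (λ c → χ (c ≟ᶜ b) * compositionWeight (value a) (value c))
    ≡⟨ ∑-point (compositions n r) b (_≟ᶜ b) (compositions-once b) (compositionWeight (value a) ∘ value) ⟩
  compositionWeight (value a) (value b) ∎
  where
  open ≡-Reasoning
  term : ∀ c → χ (c ⊵? a) * (γ-coefficient (value a) (value c) * χ (word (value c) ≟ˡ word (value b))) ≡
    χ (c ≟ᶜ b) * compositionWeight (value a) (value c)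
  term c = trans (sym (*-assoc (χ (c ⊵? a)) _ _)) (trans (*-comm _ (χ (word (value c) ≟ˡ word (value b))))
    (cong₂ _*_ (χ-⇔ (word (value c) ≟ˡ word (value b)) (c ≟ᶜ b) (word-injective c b) (cong (word ∘ value)))
      (γ-coefficient-⊵ a c)))

-- Strictly smaller for b than for a whenever b ⊵ a and b ≠ a, hence a measure
-- for solving the triangular system downwards.

potential : Composition n r → ℕ
potential {r = r} a = ∑⟨ allFin (suc r) ⟩ λ j → psum (value a) (suc (toℕ j))

potential-bound : (a : Composition n r) → potential a ≤ ∑⟨ allFin (suc r) ⟩ (λ _ → n)
potential-bound {r = r} a = ∑-mono-≤ (allFin (suc r)) λ j →
  ≤-trans (partialSum≤sum (value a) (suc (toℕ j))) (≤-reflexive (proj₂ (isComposition a)))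

-- If no partial sum dropped strictly, all would agree, and partial sums determine the composition.
potential-< : (a b : Composition n r) → b ⊵ a → a ≢ b → potential b < potential a
potential-< {r = r} a b b⊵a a≢b
  with Fin.any? (λ j → psum (value b) (suc (toℕ j)) <? psum (value a) (suc (toℕ j)))
... | no ¬any = contradiction (value-injective (partialSum-injective (value a) (value b) λ j →
        ≤-antisym (≮⇒≥ (¬any ∘ (j ,_))) (b⊵a j))) a≢b
... | yes (i , b<a) = begin-strict
  potential b
    ≡⟨ split b ⟩
  psum (value b) (suc (toℕ i)) + ∑⟨ allFin (suc r) ⟩ (λ j → χ (¬? (j Fin.≟ i)) * psum (value b) (suc (toℕ j)))
    <⟨ +-mono-<-≤ b<a (∑-mono-≤ (allFin (suc r)) λ j → *-monoʳ-≤ (χ (¬? (j Fin.≟ i))) (b⊵a j)) ⟩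
  psum (value a) (suc (toℕ i)) + ∑⟨ allFin (suc r) ⟩ (λ j → χ (¬? (j Fin.≟ i)) * psum (value a) (suc (toℕ j)))
    ≡⟨ split a ⟨
  potential a ∎
  where
  open ≤-Reasoning
  split : ∀ c → potential c ≡ psum (value c) (suc (toℕ i)) +
    ∑⟨ allFin (suc r) ⟩ (λ j → χ (¬? (j Fin.≟ i)) * psum (value c) (suc (toℕ j)))
  split c = ∑-split (allFin (suc r)) i (Fin._≟ i) (allFin-once i) λ j → psum (value c) (suc (toℕ j))

-- In the equation for `b`, a term with `a ≢ b` either has weight 0 or satisfies `b ⊵ a`, so that
-- `a` has larger potential and is settled first. What remains is the diagonal term, whose positive
-- weight cancels.
triangular : (x y : Composition n r → ℕ) →
  (∀ b → ∑⟨ compositions n r ⟩ (λ a → x a * compositionWeight (value a) (value b)) ≡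
         ∑⟨ compositions n r ⟩ (λ a → y a * compositionWeight (value a) (value b))) →
  x ≗ y
triangular {n} {r} x y eq b = go bound b (m≤m+n bound (potential b))
  where
  bound : ℕ
  bound = ∑⟨ allFin (suc r) ⟩ (λ _ → n)

  go : ∀ fuel b → bound ≤ fuel + potential b → x b ≡ y b
  above : ∀ fuel a b → bound ≤ fuel + potential b → b ⊵ a → a ≢ b → x a ≡ y a

  go fuel b enough = *-cancelʳ-≡ (x b) (y b) (W b) {{>-nonZero (compositionWeight-diagonal b)}}
    (∑-cancel (compositions n r) b (_≟ᶜ b) (compositions-once b)
      (λ a → x a * W a) (λ a → y a * W a) agree (eq b))
    where
    W : Composition n r → ℕ
    W a = compositionWeight (value a) (value b)
    agree : ∀ a → a ≢ b → x a * W a ≡ y a * W a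
    agree a a≢b with W a ≟ 0
    ... | yes W≡0 rewrite W≡0 = trans (*-zeroʳ (x a)) (sym (*-zeroʳ (y a)))
    ... | no  W≢0 = cong (_* W a) (above fuel a b enough (compositionWeight-≢0 a b W≢0) a≢b)

  -- Here the potential of `b` has reached `bound`, and that of `a` would exceed it.
  above zero       a b enough b⊵a a≢b = contradiction (potential-bound a)
    (<⇒≱ (≤-<-trans enough (potential-< a b b⊵a a≢b)))
  above (suc fuel) a b enough b⊵a a≢b = go fuel a (begin
    bound                        ≤⟨ enough ⟩
    suc fuel + potential b       ≡⟨ +-suc fuel (potential b) ⟨
    fuel + suc (potential b)     ≤⟨ +-monoʳ-≤ fuel (potential-< a b b⊵a a≢b) ⟩
    fuel + potential a           ∎)
    where open ≤-Reasoning

-- Transfer of the counts to the field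

module _ {c ℓ₁ ℓ₂} (K : HeytingField c ℓ₁ ℓ₂) where
  open OverField K
  private
    module R = CommutativeRing
      (HeytingCommutativeRing.commutativeRing (HeytingField.heytingCommutativeRing K))
  open R using (_≈_; 1#)
  open SemiringMult R.semiring using (×-homo-+; ×1-homo-*)

  -- `CharacteristicZero` speaks only of the kernel of `ι`; cancelling the unit from both sides
  -- reduces to the case where one argument is 0.
  ι-injective : CharacteristicZero → ∀ m n → ι m ≈ ι n → m ≡ n
  ι-injective char0 zero    n       eq = sym (char0 n (R.sym eq))
  ι-injective char0 (suc m) zero    eq = char0 (suc m) eq
  ι-injective char0 (suc m) (suc n) eq = cong suc (ι-injective char0 m n (+-cancelˡ 1# (ι m) (ι n) eq))
    where open GroupProperties R.+-group renaming (∙-cancelˡ to +-cancelˡ)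

  ι-χ : ∀ (s t : Sequence n r) → ⟦ s ⟧ t ≈ ι (χ (value s ≟ˡ value t))
  ι-χ s t with value s ≟ˡ value t
  ... | yes _ = R.sym (R.+-identityʳ 1#)
  ... | no _  = R.refl

  ι-∑ : (xs : List A) (g : A → 𝒢-space n r) (f : A → ℕ) (s : Sequence n r) →
    (∀ x → g x s ≈ ι (f x)) → ∑ xs g s ≈ ι (∑⟨ xs ⟩ f)
  ι-∑ []       g f s eq = R.refl
  ι-∑ (x ∷ xs) g f s eq = R.trans (R.+-cong (eq x) (ι-∑ xs g f s eq)) (R.sym (×-homo-+ 1# (f x) _))

  ι-· : ∀ m {x n} → x ≈ ι n → ι m R.* x ≈ ι (m * n)
  ι-· m {n = n} eq = R.trans (R.*-congˡ eq) (R.sym (×1-homo-* m n))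

  -- Both directions of the equivalence rest on this formula: each coefficient is the image of a
  -- natural number in which `M` appears only through `ν`.
  𝒢-at : (M : Matroid n r) (s : Sequence n r) (b : Composition n r) → word (value b) ≡ value s →
    𝒢 M s ≈ ι (∑⟨ compositions n r ⟩ λ a → ν M a * compositionWeight (value a) (value b))
  𝒢-at {n} M s b eq = R.trans
    (ι-∑ (orderings n) _ _ s λ π → ι-χ (rankSequence M π) s)
    (R.reflexive (cong ι (trans
      (ordering-count M (value s) (subst (λ w → length w ≡ n) eq (proj₁ (word-isSequence (value b) (isComposition b)))))
      (trans (cong (extensions M ∅) (sym eq)) (catenary-count M b)))))

  γ-at : (a b : Composition n r) (s : Sequence n r) → word (value b) ≡ value s →
    γ a s ≈ ι (compositionWeight (value a) (value b))
  γ-at {n} {r} a b s eq = R.trans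
    (ι-∑ (List.filter (_⊵? a) (compositions n r)) _
      (λ c → γ-coefficient (value a) (value c) * χ (word (value c) ≟ˡ value s)) s
      λ c → ι-· (γ-coefficient (value a) (value c)) (ι-χ (wordSequence c) s))
    (R.reflexive (cong ι (trans
      (∑-cong (List.filter (_⊵? a) (compositions n r)) λ c →
        cong (λ w → γ-coefficient (value a) (value c) * χ (word (value c) ≟ˡ w)) (sym eq))
      (γ-count a b))))

  𝒢≋∑νγ : (M : Matroid n r) → 𝒢 M ≋ ∑ (compositions n r) (λ a → ι (ν M a) · γ a)
  𝒢≋∑νγ {n} {r} M s with b , eq ← word-surjective s = R.trans (𝒢-at M s b eq)
    (R.sym (ι-∑ (compositions n r) _ _ s λ a → ι-· (ν M a) (γ-at a b s eq)))

theorem3p3 : ∀ {c ℓ₁ ℓ₂} (K : HeytingField c ℓ₁ ℓ₂) → let open OverField K in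
    CharacteristicZero → ∀ (n r : ℕ) →
    ((M M′ : Matroid n r) → (𝒢 M ≋ 𝒢 M′) ⇔ (catenaryData M ≗ catenaryData M′)) ×
    ((M : Matroid n r) → 𝒢 M ≋ ∑ (compositions n r) (λ a → ι (ν M a) · γ a))
theorem3p3 K char0 n r =
  (λ M M′ → mk⇔
    -- Evaluating at the word of `b` gives the equation indexed by `b`; characteristic zero brings
    -- it back to `ℕ`.
    (λ eq → triangular (ν M) (ν M′) λ b → ι-injective K char0 _ _
      (R.trans (R.sym (𝒢-at K M (wordSequence b) b refl))
        (R.trans (eq (wordSequence b)) (𝒢-at K M′ (wordSequence b) b refl))))
    -- An arbitrary sequence is a word, so `𝒢-at` applies to it and equal catenary data can be
    -- substituted.
    (λ eq s → let b , s≡ = word-surjective s in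
      R.trans (𝒢-at K M s b s≡) (R.trans
        (R.reflexive (cong ι (∑-cong (compositions n r) λ a →
          cong (_* compositionWeight (value a) (value b)) (eq a))))
        (R.sym (𝒢-at K M′ s b s≡))))) ,
  𝒢≋∑νγ K
  where
  module R = HeytingField K
  open OverField K
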